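{- For all integers $n\ge k\ge 0$, the rescaled mixed moment $\tilde\sigma^{AW,H}_{n,k}(a_1,a_2,a_3,a_4;q)$ is symmetric in $a_1,a_2,a_3,a_4$, i.e. invariant under every permutation of $a_1,a_2,a_3,a_4$. Equivalently, the mixed moment $\sigma^{AW,H}_{n,k}(a,b,c,d;q)$ of Askey--Wilson polynomials relative to continuous $q$-Hermite polynomials (and also the coefficient $\nu^{AW,H}_{n,k}(a,b,c,d;q)$) is symmetric in $a,b,c,d$.
   Context: Notation: $(z;q)_n=\prod_{i=0}^{n-1}(1-zq^i)$, $(z_1,\dots,z_r;q)_n=\prod_s(z_s;q)_n$, and ${}_r\phi_s(\alpha_1,\dots,\alpha_r;\beta_1,\dots,\beta_s;q,z)=\sum_{k\ge0}\frac{(\alpha_1,\dots,\alpha_r;q)_k}{(q,\beta_1,\dots,\beta_s;q)_k}\big((-1)^kq^{\binom k2}\big)^{1+s-r}z^k$. Let $x=\cos\theta$ and $\mathbf i=\sqrt{ -1}$; $a,b,c,d,q$ are indeterminates. The monic Askey--Wilson polynomials are \[ p_n(x;a,b,c,d|q)=\frac{(ab,ac,ad;q)_n}{2^na^n(abcdq^{n-1};q)_n}\;{}_4\phi_3\!\left(\begin{matrix}q^{ -n},\,abcdq^{n-1},\,ae^{\mathbf i\theta},\,ae^{ -\mathbf i\theta}\\ ab,\,ac,\,ad\end{matrix};q,q\right). \] The monic continuous $q$-Hermite polynomials are \[ H_n(x|q)=\frac{e^{\mathbf in\theta}}{2^n}\;{}_2\phi_0\!\left(\begin{matrix}q^{ -n},0\\-\end{matrix};q,q^ne^{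 -2\mathbf i\theta}\right). \] Define $\sigma^{AW,H}_{n,k}$ and $\nu^{AW,H}_{n,k}$ by \[ H_n(x|q)=\sum_{k=0}^n\sigma^{AW,H}_{n,k}(a,b,c,d;q)\,p_k(x;a,b,c,d|q),\qquad p_n(x;a,b,c,d|q)=\sum_{k=0}^n\nu^{AW,H}_{n,k}(a,b,c,d;q)\,H_k(x|q), \] and the rescaled mixed moments by \[ \tilde\sigma^{AW,H}_{n,k}(a,b,c,d;q)=\frac{2^{n-k}}{\mathbf i^{\,n-k}}\,\sigma^{AW,H}_{n,k}(\mathbf ia,\mathbf ib,\mathbf ic,\mathbf id;q). \] The parameters $a_1,a_2,a_3,a_4$ are used in place of $a,b,c,d$. -}

module Defs where

open import Algebra.Apartness.Bundles using (HeytingField; HeytingCommutativeRing)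
open import Algebra.Bundles using (CommutativeRing; Semiring)
open import Data.Fin.Base using (Fin; toℕ)
open import Data.Fin.Patterns using (0F; 1F; 2F; 3F)
open import Data.Integer.Base as ℤ using (ℤ; +_; -[1+_]; _⊖_)
open import Data.List.Base using (List; []; _∷_; length; map; foldr)
open import Data.Nat.Base as ℕ using (ℕ; suc; _∸_)
open import Data.Nat.Combinatorics using (_C_)
open import Data.Product.Base using (proj₁)
open import Data.Vec.Functional using (Vector)
open import Level using (_⊔_)
open import Relation.Binary.Definitions using (Decidable)
open import Relation.Binary.PropositionalEquality.Core using (_≢_)
open import Relation.Nullary.Decidable.Core using (yes; no)

-- A Heyting field with decidable apartness is a field in the classical sense;
-- decidability is only used to make _⁻¹ a total function.  The indeterminates
-- are elements of such a field at which no denominator vanishes (see Generic),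
-- for instance the generators of ℚ(i)(a₁,a₂,a₃,a₄,q).
module AskeyWilson
  {c ℓ₁ ℓ₂} (F : HeytingField c ℓ₁ ℓ₂)
  (_#?_ : Decidable (HeytingField._#_ F))
  where

  open HeytingField F

  open import Algebra.Definitions.RawSemiring
    (Semiring.rawSemiring (CommutativeRing.semiring
      (HeytingCommutativeRing.commutativeRing heytingCommutativeRing)))
    public using (_^_; sum; product)

  infix  9 _⁻¹
  infixl 7 _/_
  infixr 8 _^ᶻ_

  -- #⇒invertible applied to x # 0# yields an inverse of x - 0#.
  -- The value 0# at 0# is junk; Generic keeps it from being used.
  _⁻¹ : Carrier → Carrier
  x ⁻¹ with x #? 0#
  ... | yes x#0 = proj₁ (#⇒invertible x#0)
  ... | no  _   = 0#

  _/_ : Carrier → Carrier → Carrier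
  x / y = x * y ⁻¹

  _^ᶻ_ : Carrier → ℤ → Carrier
  x ^ᶻ (+ n)    = x ^ n
  x ^ᶻ -[1+ n ] = (x ^ suc n) ⁻¹

  2# : Carrier
  2# = 1# + 1#

  -- Σ[k≤ n ] f  =  f 0 + f 1 + … + f n
  Σ[k≤_] : ℕ → (ℕ → Carrier) → Carrier
  Σ[k≤ n ] f = sum {suc n} (λ k → f (toℕ k))

  module _ (q : Carrier) where

    -- (z ; q)ₙ
    poch : Carrier → ℕ → Carrier
    poch z n = product {n} (λ i → 1# - z * q ^ toℕ i)

    -- (z₁, …, zᵣ ; q)ₙ
    pochs : List Carrier → ℕ → Carrier
    pochs zs n = foldr (λ z r → poch z n * r) 1# zs

    -- The basic hypergeometric series ᵣφₛ(αs ; βs ; q , w), summed over k ≤ N.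
    -- When q^{-N} occurs in αs, as in every use below, this is the whole
    -- series: (q^{-N} ; q)ₖ contains the factor 1 - q^{-N} q^N for k > N.
    φ : (N : ℕ) (αs βs : List Carrier) (w : Carrier) → Carrier
    φ N αs βs w = Σ[k≤ N ] λ k →
      pochs αs k / pochs (q ∷ βs) k
        * ((- 1#) ^ k * q ^ (k C 2)) ^ᶻ (suc (length βs) ⊖ length αs)
        * w ^ k

    -- Polynomials in x = cos θ are given as functions of z = e^{iθ}, so that
    -- x = (z + z⁻¹)/2.  Two polynomials in x agree iff these functions agree
    -- for all z # 0#: if q is neither zero nor a root of unity (and 2# # 0#),
    -- the points z = q^j already give infinitely many values of x.

    askeyWilson : Vector Carrier 4 → ℕ → Carrier → Carrier
    askeyWilson p n z =
      pochs (a * b ∷ a * c′ ∷ a * d ∷ []) n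
        / (2# ^ n * a ^ n * poch abcdqⁿ⁻¹ n)
        * φ n (q ^ᶻ (ℤ.- (+ n)) ∷ abcdqⁿ⁻¹ ∷ a * z ∷ a * z ⁻¹ ∷ [])
              (a * b ∷ a * c′ ∷ a * d ∷ []) q
      where
      a  = p 0F
      b  = p 1F
      c′ = p 2F
      d  = p 3F
      abcdqⁿ⁻¹ = a * b * c′ * d * q ^ᶻ (n ⊖ 1)

    qHermite : ℕ → Carrier → Carrier
    qHermite n z =
      z ^ n / 2# ^ n
        * φ n (q ^ᶻ (ℤ.- (+ n)) ∷ 0# ∷ []) [] (q ^ n * z ^ᶻ (ℤ.- (+ 2)))

    -- The nonvanishing of every denominator in the definition of the
    -- Askey–Wilson polynomials, whichever parameter plays the role of a.
    record Generic (a : Vector Carrier 4) : Set (c ⊔ ℓ₂) where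
      field
        q#0        : q # 0#
        qᵐ#1       : ∀ m → q ^ suc m # 1#
        a#0        : ∀ i → a i # 0#
        aᵢaⱼqᵐ#1   : ∀ {i j} → i ≢ j → ∀ m → a i * a j * q ^ m # 1#
        abcdqᵐ#1   : ∀ m → a 0F * a 1F * a 2F * a 3F * q ^ m # 1#

    -- fₙ(x) = Σ_{k≤n} s n k gₖ(x) for all n.  Only the entries s n k with
    -- k ≤ n are constrained.
    IsConnection : (f g : ℕ → Carrier → Carrier) →
                   (ℕ → ℕ → Carrier) → Set (c ⊔ ℓ₁ ⊔ ℓ₂)
    IsConnection f g s =
      ∀ n z → z # 0# → f n z ≈ Σ[k≤ n ] (λ k → s n k * g k z)

    -- s n k = σ^{AW,H}_{n,k}(a ; q)
    IsMixedMoment : Vector Carrier 4 → (ℕ → ℕ → Carrier) → Set (c ⊔ ℓ₁ ⊔ ℓ₂)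
    IsMixedMoment a = IsConnection qHermite (askeyWilson a)

    -- s n k = ν^{AW,H}_{n,k}(a ; q)
    IsDualMixedMoment : Vector Carrier 4 → (ℕ → ℕ → Carrier) → Set (c ⊔ ℓ₁ ⊔ ℓ₂)
    IsDualMixedMoment a = IsConnection (askeyWilson a) qHermite

  _·_ : Carrier → Vector Carrier 4 → Vector Carrier 4
  (x · a) i = x * a i

  -- Turns σ^{AW,H}(ia ; q) into σ̃^{AW,H}(a ; q); meant for k ≤ n.
  rescale : (𝐢 : Carrier) → (ℕ → ℕ → Carrier) → ℕ → ℕ → Carrier
  rescale 𝐢 s n k = 2# ^ (n ∸ k) / 𝐢 ^ (n ∸ k) * s n k

module Submission where

-- The Askey–Wilson polynomial pₙ is an eigenfunction of the Askey–Wilson q-difference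
-- operator, which is symmetric in a, b, c, d.  On the basis φₖ(z) = (az, a/z; q)ₖ this
-- operator is bidiagonal with diagonal entries λₖ that are pairwise apart, so an
-- eigenfunction for λₙ in the span of φ₀, …, φₙ is determined by its φₙ-coefficient.
-- Since aⁿ times that coefficient of pₙ does not involve the parameters, pₙ is symmetric.
-- The mixed moments are then symmetric because connection coefficients are unique, i.e.
-- the pₙ and the Hₙ are linearly independent.

open import Defs
open import Algebra.Apartness.Bundles using (HeytingField; HeytingCommutativeRing)
open import Algebra.Bundles using (CommutativeRing)
open import Data.Fin.Base using (toℕ)
open import Data.Fin.Patterns using (0F; 1F; 2F; 3F)
open import Data.Fin.Permutation using (Permutation′; _⟨$⟩ʳ_)
open import Data.Integer.Base as ℤ using (ℤ; +_; -[1+_]; _⊖_)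
import Data.Integer.Properties as ℤ
open import Data.List.Base using ([]; _∷_)
open import Data.Maybe.Base using (Maybe; just; nothing)
open import Data.Nat.Base as ℕ using (ℕ; zero; suc; _≤_; _<_; s≤s; z≤n; _∸_)
import Data.Nat.Properties as ℕ
open import Data.Product.Base using (_×_; _,_; ∃; proj₁; proj₂)
open import Data.Sum.Base using (inj₁; inj₂)
open import Data.Vec.Functional using (Vector)
open import Function.Base using (_∘_)
open import Function.Bundles using (Injection)
open import Function.Properties.Inverse using (↔⇒↣)
open import Level using (_⊔_)
open import Relation.Binary.Definitions using (Decidable)
open import Relation.Binary.PropositionalEquality.Core as ≡ using (_≡_; _≢_)
open import Relation.Nullary.Decidable.Core using (yes; no)
open import Relation.Nullary.Negation using (contradiction)

-- Polynomials in x occur only as functions of z, so every statement about coefficients has to be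
-- recovered from values. The test points are z = q^(j+1): they are closed under z ↦ qz, and since q
-- is not a root of unity, every factor that must be cancelled is nonzero there. The exponent starts
-- at 1 because z = 1 is a pole of the Askey-Wilson operator. The poles are also why the operator is
-- multiplied by a polynomial W: the eigenvalue equation reads Df = Wλf for all nonzero z, and W is
-- cancelled at test points only. The basis φₖ belongs to the parameter in first position, which a
-- permutation may change from a to b. Both polynomials are compared after a triangular change of
-- basis from (bz, b/z; q)ₖ to (az, a/z; q)ₖ. Its diagonal entry is (b/a)^k, which is exactly what
-- the factor aⁿ on the top coefficient compensates.

-- A ring solver with integer coefficients

module IntegerCoefficients {c ℓ} (R : CommutativeRing c ℓ) where
  open CommutativeRing R
  open import Algebra.Properties.Ring ring
  open import Algebra.Properties.Semiring.Mult.TCOptimised semiring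
    renaming (_×_ to _×ᵣ_)
  open import Algebra.Solver.Ring.AlmostCommutativeRing
  open import Algebra.Properties.CommutativeSemigroup +-commutativeSemigroup
    using (interchange)
  open import Algebra.Properties.AbelianGroup +-abelianGroup using (⁻¹-∙-comm)
  open import Relation.Binary.Reasoning.Setoid setoid

  -- The optimised multiple makes `1 ×ᵣ 1#` reduce to `1#`, so the solver constant `con (+ 1)`
  -- denotes `1#` on the nose. Integers serve as coefficients because their equality evaluates,
  -- which lets the solver cancel terms.
  fromℤ : ℤ → Carrier
  fromℤ (+ n)    = n ×ᵣ 1#
  fromℤ -[1+ n ] = - (suc n ×ᵣ 1#)

  fromℤ-⊖ : ∀ m n → fromℤ (m ⊖ n) ≈ m ×ᵣ 1# - n ×ᵣ 1#
  fromℤ-⊖ m       zero    = sym (trans (+-congˡ -0#≈0#) (+-identityʳ _))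
  fromℤ-⊖ zero    (suc n) = sym (+-identityˡ _)
  fromℤ-⊖ (suc m) (suc n) = begin
    fromℤ (suc m ⊖ suc n)               ≡⟨ ≡.cong fromℤ (ℤ.[1+m]⊖[1+n]≡m⊖n m n) ⟩
    fromℤ (m ⊖ n)                       ≈⟨ fromℤ-⊖ m n ⟩
    m ×ᵣ 1# - n ×ᵣ 1#                     ≈⟨ +-identityˡ _ ⟨
    0# + (m ×ᵣ 1# - n ×ᵣ 1#)              ≈⟨ +-congʳ (-‿inverseʳ 1#) ⟨
    (1# - 1#) + (m ×ᵣ 1# - n ×ᵣ 1#)       ≈⟨ interchange _ _ _ _ ⟩
    (1# + m ×ᵣ 1#) + (- 1# - n ×ᵣ 1#)     ≈⟨ +-congˡ (⁻¹-∙-comm _ _) ⟩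
    (1# + m ×ᵣ 1#) - (1# + n ×ᵣ 1#)       ≈⟨ +-cong (1+× m 1#) (-‿cong (1+× n 1#)) ⟨
    suc m ×ᵣ 1# - suc n ×ᵣ 1#             ∎

  fromℤ-neg : ∀ i → fromℤ (ℤ.- i) ≈ - fromℤ i
  fromℤ-neg (+ zero)   = sym -0#≈0#
  fromℤ-neg (+ suc n)  = refl
  fromℤ-neg -[1+ n ]   = sym (-‿involutive _)

  fromℤ-+ : ∀ i j → fromℤ (i ℤ.+ j) ≈ fromℤ i + fromℤ j
  fromℤ-+ (+ m)    (+ n)    = ×-homo-+ 1# m n
  fromℤ-+ (+ m)    -[1+ n ] = fromℤ-⊖ m (suc n)
  fromℤ-+ -[1+ m ] (+ n)    = trans (fromℤ-⊖ n (suc m)) (+-comm _ _)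
  fromℤ-+ -[1+ m ] -[1+ n ] = begin
    - (suc (suc (m ℕ.+ n)) ×ᵣ 1#)        ≡⟨ ≡.cong (λ k → - (suc k ×ᵣ 1#)) (ℕ.+-suc m n) ⟨
    - ((suc m ℕ.+ suc n) ×ᵣ 1#)          ≈⟨ -‿cong (×-homo-+ 1# (suc m) (suc n)) ⟩
    - (suc m ×ᵣ 1# + suc n ×ᵣ 1#)         ≈⟨ ⁻¹-∙-comm _ _ ⟨
    - (suc m ×ᵣ 1#) - (suc n ×ᵣ 1#)       ∎

  fromℤ-*⁺ : ∀ m j → fromℤ (+ m ℤ.* j) ≈ m ×ᵣ 1# * fromℤ j
  fromℤ-*⁺ m (+ n) = trans (reflexive (≡.cong fromℤ (≡.sym (ℤ.pos-* m n)))) (×1-homo-* m n)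
  fromℤ-*⁺ m -[1+ n ] = begin
    fromℤ (+ m ℤ.* ℤ.- + suc n)         ≡⟨ ≡.cong fromℤ (ℤ.neg-distribʳ-* (+ m) (+ suc n)) ⟨
    fromℤ (ℤ.- (+ m ℤ.* + suc n))       ≈⟨ fromℤ-neg (+ m ℤ.* + suc n) ⟩
    - fromℤ (+ m ℤ.* + suc n)           ≈⟨ -‿cong (fromℤ-*⁺ m (+ suc n)) ⟩
    - (m ×ᵣ 1# * (suc n ×ᵣ 1#))           ≈⟨ -‿distribʳ-* _ _ ⟩
    m ×ᵣ 1# * - (suc n ×ᵣ 1#)             ∎

  fromℤ-* : ∀ i j → fromℤ (i ℤ.* j) ≈ fromℤ i * fromℤ j
  fromℤ-* (+ m)    j = fromℤ-*⁺ m j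
  fromℤ-* -[1+ m ] j = begin
    fromℤ (ℤ.- + suc m ℤ.* j)           ≡⟨ ≡.cong fromℤ (ℤ.neg-distribˡ-* (+ suc m) j) ⟨
    fromℤ (ℤ.- (+ suc m ℤ.* j))         ≈⟨ fromℤ-neg (+ suc m ℤ.* j) ⟩
    - fromℤ (+ suc m ℤ.* j)             ≈⟨ -‿cong (fromℤ-*⁺ (suc m) j) ⟩
    - (suc m ×ᵣ 1# * fromℤ j)            ≈⟨ -‿distribˡ-* _ _ ⟩
    - (suc m ×ᵣ 1#) * fromℤ j            ∎


  fromℤ-homomorphism : ℤ.+-*-rawRing -Raw-AlmostCommutative⟶ fromCommutativeRing R
  fromℤ-homomorphism = record
    { ⟦_⟧    = fromℤ
    ; +-homo = fromℤ-+
    ; *-homo = fromℤ-*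
    ; -‿homo = fromℤ-neg
    ; 0-homo = refl
    ; 1-homo = refl
    }

  fromℤ-≟ : ∀ i j → Maybe (fromℤ i ≈ fromℤ j)
  fromℤ-≟ i j with i ℤ.≟ j
  ... | yes i≡j = just (reflexive (≡.cong fromℤ i≡j))
  ... | no  _   = nothing

  open import Algebra.Solver.Ring ℤ.+-*-rawRing (fromCommutativeRing R)
    fromℤ-homomorphism fromℤ-≟ public using (solve; _:+_; _:*_; _:-_; :-_; con; _:=_; _:^_)

-- Field arithmetic, finite sums, spans and independence

module Field
  {c ℓ₁ ℓ₂} (F : HeytingField c ℓ₁ ℓ₂)
  (_#?_ : Decidable (HeytingField._#_ F))
  where

  open HeytingField F
  open AskeyWilson F _#?_
  R : CommutativeRing c ℓ₁
  R = HeytingCommutativeRing.commutativeRing heytingCommutativeRing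
  open CommutativeRing R using (ring; commutativeSemiring; *-commutativeMonoid) public
  open import Algebra.Apartness.Properties.HeytingCommutativeRing heytingCommutativeRing public
  open IntegerCoefficients R public
    using (solve; _:+_; _:*_; _:-_; :-_; con; _:=_; _:^_)
  open import Algebra.Properties.Ring ring public using (x≈y⇒x∙y⁻¹≈ε; x∙y⁻¹≈ε⇒x≈y)
  open import Algebra.Properties.CommutativeSemiring.Exp commutativeSemiring public
    using (^-homo-*; ^-distrib-*)
  open import Relation.Binary.Reasoning.Setoid setoid

  private variable
    x y z u v : Carrier
    m n : ℕ

  ⁻¹-inverseʳ : x # 0# → x * x ⁻¹ ≈ 1#
  ⁻¹-inverseʳ {x} x#0 with x #? 0#
  ... | yes p = trans (*-congʳ (sym (x-0≈x x))) (proj₂ (proj₂ (#⇒invertible p)))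
  ... | no ¬p = contradiction x#0 ¬p

  ⁻¹-inverseˡ : x # 0# → x ⁻¹ * x ≈ 1#
  ⁻¹-inverseˡ x#0 = trans (*-comm _ _) (⁻¹-inverseʳ x#0)

  xy≈1⇒x#0 : x * y ≈ 1# → x # 0#
  xy≈1⇒x#0 {x} {y} xy≈1 = invertibleʳ⇒# (y , trans (*-congʳ (x-0≈x x)) xy≈1)

  xy≈1⇒y≈x⁻¹ : x * y ≈ 1# → y ≈ x ⁻¹
  xy≈1⇒y≈x⁻¹ {x} {y} xy≈1 = begin
    y                ≈⟨ *-identityˡ y ⟨
    1# * y           ≈⟨ *-congʳ (⁻¹-inverseˡ (xy≈1⇒x#0 xy≈1)) ⟨
    x ⁻¹ * x * y     ≈⟨ *-assoc _ _ _ ⟩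
    x ⁻¹ * (x * y)   ≈⟨ *-congˡ xy≈1 ⟩
    x ⁻¹ * 1#        ≈⟨ *-identityʳ _ ⟩
    x ⁻¹             ∎

  ⁻¹-cong : x # 0# → x ≈ y → x ⁻¹ ≈ y ⁻¹
  ⁻¹-cong x#0 x≈y = xy≈1⇒y≈x⁻¹ (trans (*-congʳ (sym x≈y)) (⁻¹-inverseʳ x#0))

  ⁻¹-*-homo : x # 0# → y # 0# → x ⁻¹ * y ⁻¹ ≈ (x * y) ⁻¹
  ⁻¹-*-homo {x} {y} x#0 y#0 = xy≈1⇒y≈x⁻¹ (begin
    x * y * (x ⁻¹ * y ⁻¹)     ≈⟨ solve 4 (λ x y u v → x :* y :* (u :* v) := x :* u :* (y :* v)) refl x y (x ⁻¹) (y ⁻¹) ⟩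
    x * x ⁻¹ * (y * y ⁻¹)     ≈⟨ *-cong (⁻¹-inverseʳ x#0) (⁻¹-inverseʳ y#0) ⟩
    1# * 1#                   ≈⟨ *-identityˡ _ ⟩
    1#                        ∎)

  ⁻¹#0 : x # 0# → x ⁻¹ # 0#
  ⁻¹#0 x#0 = xy≈1⇒x#0 (⁻¹-inverseˡ x#0)

  *-#0 : x # 0# → y # 0# → x * y # 0#
  *-#0 = x#0y#0→xy#0

  /-#0 : x # 0# → y # 0# → x / y # 0#
  /-#0 x#0 y#0 = *-#0 x#0 (⁻¹#0 y#0)

  *-#0⇒#0ˡ : x * y # 0# → x # 0#
  *-#0⇒#0ˡ xy#0 = xy≈1⇒x#0 (trans (sym (*-assoc _ _ _)) (⁻¹-inverseʳ xy#0))

  x≈0⇒x*y≈0 : x ≈ 0# → x * y ≈ 0#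
  x≈0⇒x*y≈0 x≈0 = trans (*-congʳ x≈0) (zeroˡ _)

  xy≈0⇒y≈0 : x # 0# → x * y ≈ 0# → y ≈ 0#
  xy≈0⇒y≈0 {x} {y} x#0 xy≈0 = begin
    y                ≈⟨ *-identityˡ y ⟨
    1# * y           ≈⟨ *-congʳ (⁻¹-inverseˡ x#0) ⟨
    x ⁻¹ * x * y     ≈⟨ *-assoc _ _ _ ⟩
    x ⁻¹ * (x * y)   ≈⟨ *-congˡ xy≈0 ⟩
    x ⁻¹ * 0#        ≈⟨ zeroʳ _ ⟩
    0#               ∎

  xy≈0⇒x≈0 : y # 0# → x * y ≈ 0# → x ≈ 0#
  xy≈0⇒x≈0 y#0 xy≈0 = xy≈0⇒y≈0 y#0 (trans (*-comm _ _) xy≈0)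

  *-cancelˡ : x # 0# → x * y ≈ x * z → y ≈ z
  *-cancelˡ {x} {y} {z} x#0 xy≈xz = x∙y⁻¹≈ε⇒x≈y _ _ (xy≈0⇒y≈0 x#0 (begin
    x * (y - z)      ≈⟨ solve 3 (λ x y z → x :* (y :- z) := x :* y :- x :* z) refl x y z ⟩
    x * y - x * z    ≈⟨ x≈y⇒x∙y⁻¹≈ε xy≈xz ⟩
    0#               ∎))

  x#y⇒x-y#0 : x # y → x - y # 0#
  x#y⇒x-y#0 x#y = xy≈1⇒x#0 (proj₂ (proj₂ (#⇒invertible x#y)))

  x#y⇒y-x#0 : x # y → y - x # 0#
  x#y⇒y-x#0 x#y = x#y⇒x-y#0 (#-sym x#y)

  x-y#0⇒x#y : x - y # 0# → x # y
  x-y#0⇒x#y x-y#0 = invertibleʳ⇒# (_ , ⁻¹-inverseʳ x-y#0)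

  -‿#0 : x # 0# → - x # 0#
  -‿#0 {x} x#0 = xy≈1⇒x#0 (trans (solve 2 (λ x i → :- x :* :- i := x :* i) refl x (x ⁻¹)) (⁻¹-inverseʳ x#0))

  ^-#0 : x # 0# → ∀ n → x ^ n # 0#
  ^-#0 x#0 zero    = 1#0
  ^-#0 x#0 (suc n) = *-#0 x#0 (^-#0 x#0 n)

  -- The last term is split off, unlike in `sum`, because inductions on the degree peel off the top
  -- term.
  ∑< : ℕ → (ℕ → Carrier) → Carrier
  ∑< zero    f = 0#
  ∑< (suc n) f = ∑< n f + f n

  ∑<-cong : ∀ n {f g} → (∀ k → k < n → f k ≈ g k) → ∑< n f ≈ ∑< n g
  ∑<-cong zero    f≈g = refl
  ∑<-cong (suc n) f≈g = +-cong (∑<-cong n (λ k k<n → f≈g k (ℕ.m≤n⇒m≤1+n k<n))) (f≈g n ℕ.≤-refl)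

  ∑<-cons : ∀ n f → f 0 + ∑< n (f ∘ suc) ≈ ∑< (suc n) f
  ∑<-cons zero    f = +-comm _ _
  ∑<-cons (suc n) f = trans (sym (+-assoc _ _ _)) (+-congʳ (∑<-cons n f))

  sum≈∑< : ∀ n f → sum {n} (f ∘ toℕ) ≈ ∑< n f
  sum≈∑< zero    f = refl
  sum≈∑< (suc n) f = trans (+-congˡ (sum≈∑< n (f ∘ suc))) (∑<-cons n f)

  *-distribˡ-∑< : ∀ x n f → x * ∑< n f ≈ ∑< n (λ k → x * f k)
  *-distribˡ-∑< x zero    f = zeroʳ x
  *-distribˡ-∑< x (suc n) f = trans (distribˡ _ _ _) (+-congʳ (*-distribˡ-∑< x n f))

  ∑<-minus : ∀ n f g → ∑< n (λ k → f k - g k) ≈ ∑< n f - ∑< n g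
  ∑<-minus zero    f g = sym (-‿inverseʳ 0#)
  ∑<-minus (suc n) f g = trans (+-congʳ (∑<-minus n f g))
    (solve 4 (λ a b c d → a :- b :+ (c :- d) := a :+ c :- (b :+ d)) refl _ _ _ _)

  infix 4 _≐_
  _≐_ : (f g : Carrier → Carrier) → Set (c ⊔ ℓ₁ ⊔ ℓ₂)
  f ≐ g = ∀ z → z # 0# → f z ≈ g z

  -- Only the top coefficient is claimed to vanish, which is what a degree argument yields.
  -- `independent⇒≈0` reaches the others by discarding the top term and descending.
  Independent : (ℕ → Carrier → Carrier) → Set (c ⊔ ℓ₁ ⊔ ℓ₂)
  Independent p = ∀ n (t : ℕ → Carrier) →
    (λ z → ∑< (suc n) (λ k → t k * p k z)) ≐ (λ _ → 0#) → t n ≈ 0#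

  independent⇒≈0 : ∀ {p} → Independent p → ∀ n t →
    (λ z → ∑< (suc n) (λ k → t k * p k z)) ≐ (λ _ → 0#) → ∀ k → k ≤ n → t k ≈ 0#
  independent⇒≈0 {p} ind n t ∑≈0 k k≤n with ℕ.m≤n⇒m<n∨m≡n k≤n
  ... | inj₂ ≡.refl = ind n t ∑≈0
  independent⇒≈0 {p} ind (suc n) t ∑≈0 k k≤n | inj₁ (s≤s k≤n′) =
    independent⇒≈0 ind n t (λ z z#0 → begin
      ∑< (suc n) (λ k → t k * p k z)         ≈⟨ +-identityʳ _ ⟨
      ∑< (suc n) (λ k → t k * p k z) + 0#    ≈⟨ +-congˡ (x≈0⇒x*y≈0 (ind (suc n) t ∑≈0)) ⟨
      ∑< (suc (suc n)) (λ k → t k * p k z)   ≈⟨ ∑≈0 z z#0 ⟩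
      0#                                     ∎) k k≤n′

  connection-unique : ∀ q {f p s s′} → Independent p →
    IsConnection q f p s → IsConnection q f p s′ → ∀ n k → k ≤ n → s n k ≈ s′ n k
  connection-unique q {f} {p} {s} {s′} ind fs fs′ n k k≤n =
    x∙y⁻¹≈ε⇒x≈y _ _ (independent⇒≈0 ind n (λ k → s n k - s′ n k) (λ z z#0 → begin
      ∑< (suc n) (λ k → (s n k - s′ n k) * p k z)
        ≈⟨ ∑<-cong (suc n) (λ k _ → solve 3 (λ s s′ p → (s :- s′) :* p := s :* p :- s′ :* p) refl (s n k) (s′ n k) (p k z)) ⟩
      ∑< (suc n) (λ k → s n k * p k z - s′ n k * p k z)
        ≈⟨ ∑<-minus (suc n) _ _ ⟩
      ∑< (suc n) (λ k → s n k * p k z) - ∑< (suc n) (λ k → s′ n k * p k z)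
        ≈⟨ x≈y⇒x∙y⁻¹≈ε (trans (sym (sum≈∑< (suc n) (λ k → s n k * p k z))) (trans (sym (fs n z z#0))
             (trans (fs′ n z z#0) (sum≈∑< (suc n) (λ k → s′ n k * p k z))))) ⟩
      0# ∎) k k≤n)

  -- Below ψ m f: f lies in the span of ψ 0, …, ψ (m - 1).
  data Below (ψ : ℕ → Carrier → Carrier) : ℕ → (Carrier → Carrier) → Set (c ⊔ ℓ₁ ⊔ ℓ₂) where
    none   : ∀ {f} → f ≐ (λ _ → 0#) → Below ψ 0 f
    adjoin : ∀ {m f g} → Below ψ m g → ∀ a → f ≐ (λ z → g z + a * ψ m z) → Below ψ (suc m) f

  module _ {ψ : ℕ → Carrier → Carrier} where

    Below-resp : ∀ {m f g} → f ≐ g → Below ψ m f → Below ψ m g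
    Below-resp f≐g (none f≐0)       = none (λ z z#0 → trans (sym (f≐g z z#0)) (f≐0 z z#0))
    Below-resp f≐g (adjoin b a f≐h) = adjoin b a (λ z z#0 → trans (sym (f≐g z z#0)) (f≐h z z#0))

    Below-suc : ∀ {m f} → Below ψ m f → Below ψ (suc m) f
    Below-suc b = adjoin b 0# (λ z _ → solve 2 (λ f p → f := f :+ con (+ 0) :* p) refl _ (ψ _ z))

    Below-≤ : ∀ {m n f} → m ≤ n → Below ψ m f → Below ψ n f
    Below-≤ {m} {zero}  z≤n b = b
    Below-≤ {m} {suc n} m≤n b with ℕ.m≤n⇒m<n∨m≡n m≤n
    ... | inj₁ (s≤s m≤n′) = Below-suc (Below-≤ m≤n′ b)
    ... | inj₂ ≡.refl     = b

    Below-0 : ∀ m → Below ψ m (λ _ → 0#)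
    Below-0 zero    = none (λ _ _ → refl)
    Below-0 (suc m) = Below-suc (Below-0 m)

    Below-ψ : ∀ m a → Below ψ (suc m) (λ z → a * ψ m z)
    Below-ψ m a = adjoin (Below-0 m) a (λ z _ → sym (+-identityˡ _))

    Below-+ : ∀ {m f g} → Below ψ m f → Below ψ m g → Below ψ m (λ z → f z + g z)
    Below-+ (none f≐0) (none g≐0) =
      none (λ z z#0 → trans (+-cong (f≐0 z z#0) (g≐0 z z#0)) (+-identityˡ 0#))
    Below-+ {suc m} (adjoin b a f≐) (adjoin b′ a′ g≐) =
      adjoin (Below-+ b b′) (a + a′) (λ z z#0 → trans (+-cong (f≐ z z#0) (g≐ z z#0))
        (solve 5 (λ f a p g b → f :+ a :* p :+ (g :+ b :* p) := f :+ g :+ (a :+ b) :* p) refl _ a (ψ m z) _ a′))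

    Below-* : ∀ {m f} x → Below ψ m f → Below ψ m (λ z → x * f z)
    Below-* x (none f≐0) = none (λ z z#0 → trans (*-congˡ (f≐0 z z#0)) (zeroʳ x))
    Below-* {suc m} x (adjoin b a f≐) = adjoin (Below-* x b) (x * a) (λ z z#0 → trans (*-congˡ (f≐ z z#0))
        (solve 4 (λ x f a p → x :* (f :+ a :* p) := x :* f :+ x :* a :* p) refl x _ a (ψ m z)))

    Below-∑< : ∀ {m} n (f : ℕ → Carrier → Carrier) → (∀ k → k < n → Below ψ m (f k)) → Below ψ m (λ z → ∑< n (λ k → f k z))
    Below-∑< zero    f b = Below-0 _
    Below-∑< (suc n) f b = Below-+ (Below-∑< n f (λ k k<n → b k (ℕ.m≤n⇒m≤1+n k<n))) (b n ℕ.≤-refl)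

  Below-map : ∀ {ψ ψ′} → (∀ k → Below ψ′ (suc k) (ψ k)) → ∀ {m f} → Below ψ m f → Below ψ′ m f
  Below-map h (none f≐0)             = none f≐0
  Below-map h (adjoin {m = m} b a f≐) =
    Below-resp (λ z z#0 → sym (f≐ z z#0)) (Below-+ (Below-suc (Below-map h b)) (Below-* a (h m)))

  -- The difference f(qz) - f(z) lowers the degree in a family ψ i, up to the factor d i z,
  -- and passes to the family ψ (suc i).  Iterating it isolates the top coefficient, so
  -- independence is proved without factoring out roots.
  module Lowering (q : Carrier) (q#0 : q # 0#) (qᵐ#1 : ∀ m → q ^ suc m # 1#)
    (ψ : ℕ → ℕ → Carrier → Carrier) (d : ℕ → Carrier → Carrier)
    (ψ-zero : ∀ i z → ψ i 0 z ≈ 1#)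
    (ψ-suc : ∀ i k z → z # 0# →
       ψ i (suc k) (q * z) - ψ i (suc k) z ≈ (1# - q ^ suc k) * (d i z * ψ (suc i) k z))
    (d#0 : ∀ i j → d i (q ^ suc j) # 0#)
    where

    lower : ∀ i {m f} → Below (ψ i) (suc m) f →
      ∃ λ g → Below (ψ (suc i)) m g × (λ z → f (q * z) - f z) ≐ (λ z → d i z * g z)
    lower i {zero} {f} (adjoin {g = g} (none g≐0) a f≐) = (λ _ → 0#) , Below-0 0 , λ z z#0 → begin
      f (q * z) - f z        ≈⟨ x≈y⇒x∙y⁻¹≈ε (trans (f≐a (q * z) (*-#0 q#0 z#0)) (sym (f≐a z z#0))) ⟩
      0#                     ≈⟨ zeroʳ _ ⟨
      d i z * 0#             ∎
      where
      f≐a : ∀ z → z # 0# → f z ≈ 0# + a * 1#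
      f≐a z z#0 = trans (f≐ z z#0) (+-cong (g≐0 z z#0) (*-congˡ (ψ-zero i z)))
    lower i {suc m} {f} (adjoin {g = g} b a f≐) with lower i b
    ... | g′ , b′ , g≐ = _ , adjoin b′ (a * (1# - q ^ suc m)) (λ _ _ → refl) , λ z z#0 → begin
      f (q * z) - f z
        ≈⟨ +-cong (f≐ (q * z) (*-#0 q#0 z#0)) (-‿cong (f≐ z z#0)) ⟩
      (g (q * z) + a * ψ i (suc m) (q * z)) - (g z + a * ψ i (suc m) z)
        ≈⟨ solve 5 (λ g a p h r → g :+ a :* p :- (h :+ a :* r) := g :- h :+ a :* (p :- r)) refl _ a _ _ _ ⟩
      g (q * z) - g z + a * (ψ i (suc m) (q * z) - ψ i (suc m) z)
        ≈⟨ +-cong (g≐ z z#0) (*-congˡ (ψ-suc i m z z#0)) ⟩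
      d i z * g′ z + a * ((1# - q ^ suc m) * (d i z * ψ (suc i) m z))
        ≈⟨ solve 5 (λ d g a r p → d :* g :+ a :* (r :* (d :* p)) := d :* (g :+ a :* r :* p)) refl (d i z) (g′ z) a _ _ ⟩
      d i z * (g′ z + a * (1# - q ^ suc m) * ψ (suc i) m z) ∎

    -- The points q^(j+1) are closed under z ↦ qz, so the q-difference of a function vanishing on
    -- them vanishes there too. After division by `d i z` its top coefficient in the family
    -- `ψ (suc i)` is `a * (1# - q ^ suc m)`, whose second factor is invertible.
    vanishing⇒top≈0 : ∀ {i m g} → Below (ψ i) m g → ∀ a →
      (∀ j → g (q ^ suc j) + a * ψ i m (q ^ suc j) ≈ 0#) → a ≈ 0#
    vanishing⇒top≈0 {i} {zero} {g} (none g≐0) a f≈0 = begin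
      a                                ≈⟨ solve 1 (λ a → a := con (+ 0) :+ a :* con (+ 1)) refl a ⟩
      0# + a * 1#                      ≈⟨ +-cong (g≐0 _ (^-#0 q#0 1)) (*-congˡ (ψ-zero i _)) ⟨
      g (q ^ 1) + a * ψ i 0 (q ^ 1)    ≈⟨ f≈0 0 ⟩
      0#                               ∎
    vanishing⇒top≈0 {i} {suc m} {g} b a f≈0 with lower i b
    ... | g′ , b′ , g≐ = xy≈0⇒x≈0 (x#y⇒y-x#0 (qᵐ#1 m)) (vanishing⇒top≈0 b′ (a * (1# - q ^ suc m)) λ j →
      let z = q ^ suc j ; z#0 = ^-#0 q#0 (suc j) in
      xy≈0⇒y≈0 (d#0 i j) (begin
      d i z * (g′ z + a * (1# - q ^ suc m) * ψ (suc i) m z)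
        ≈⟨ solve 5 (λ d g a r p → d :* g :+ a :* (r :* (d :* p)) := d :* (g :+ a :* r :* p)) refl (d i z) (g′ z) a _ _ ⟨
      d i z * g′ z + a * ((1# - q ^ suc m) * (d i z * ψ (suc i) m z))
        ≈⟨ +-cong (g≐ z z#0) (*-congˡ (ψ-suc i m z z#0)) ⟨
      g (q * z) - g z + a * (ψ i (suc m) (q * z) - ψ i (suc m) z)
        ≈⟨ solve 5 (λ g a p h r → g :+ a :* p :- (h :+ a :* r) := g :- h :+ a :* (p :- r)) refl _ a _ _ _ ⟨
      (g (q * z) + a * ψ i (suc m) (q * z)) - (g z + a * ψ i (suc m) z)
        ≈⟨ +-cong (f≈0 (suc j)) (-‿cong (f≈0 j)) ⟩
      0# - 0#   ≈⟨ -‿inverseʳ 0# ⟩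
      0#        ∎))

-- q-shifted factorials and the basis (az, a/z; q)ₖ

module Pochhammer
  {c ℓ₁ ℓ₂} (F : HeytingField c ℓ₁ ℓ₂)
  (_#?_ : Decidable (HeytingField._#_ F))
  (q : HeytingField.Carrier F)
  where

  open HeytingField F
  open AskeyWilson F _#?_ hiding (poch; φ)
  open Field F _#?_
  open import Algebra.Properties.CommutativeMonoid.Sum *-commutativeMonoid public
    using () renaming (sum-cong-≋ to product-cong; sum-permute to product-permute)
  open import Relation.Binary.Reasoning.Setoid setoid

  poch : Carrier → ℕ → Carrier
  poch = AskeyWilson.poch F _#?_ q

  poch-cong : ∀ {u v} n → u ≈ v → poch u n ≈ poch v n
  poch-cong n u≈v = product-cong {n} (λ i → +-congˡ (-‿cong (*-congʳ u≈v)))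

  poch-cons : ∀ u n → poch u (suc n) ≈ (1# - u) * poch (q * u) n
  poch-cons u n = *-cong (+-congˡ (-‿cong (*-identityʳ u))) (product-cong {n} (λ i →
    +-congˡ (-‿cong (solve 3 (λ u q Q → u :* (q :* Q) := q :* u :* Q) refl u q (q ^ toℕ i)))))

  poch-snoc : ∀ u n → poch u (suc n) ≈ poch u n * (1# - u * q ^ n)
  poch-snoc u zero    = trans (*-identityʳ _) (sym (*-identityˡ _))
  poch-snoc u (suc n) = begin
    poch u (suc (suc n))                                  ≈⟨ poch-cons u (suc n) ⟩
    (1# - u) * poch (q * u) (suc n)                       ≈⟨ *-congˡ (poch-snoc (q * u) n) ⟩
    (1# - u) * (poch (q * u) n * (1# - q * u * q ^ n))
      ≈⟨ solve 4 (λ u q U Q → (con (+ 1) :- u) :* (U :* (con (+ 1) :- q :* u :* Q))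
           := (con (+ 1) :- u) :* U :* (con (+ 1) :- u :* (q :* Q))) refl u q _ _ ⟩
    (1# - u) * poch (q * u) n * (1# - u * q ^ suc n)      ≈⟨ *-congʳ (poch-cons u n) ⟨
    poch u (suc n) * (1# - u * q ^ suc n)                 ∎

  poch-#0 : ∀ u n → (∀ i → i < n → u * q ^ i # 1#) → poch u n # 0#
  poch-#0 u zero    _   = 1#0
  poch-#0 u (suc n) u#1 = #-congʳ (sym (poch-snoc u n))
    (*-#0 (poch-#0 u n (λ i i<n → u#1 i (ℕ.m≤n⇒m≤1+n i<n))) (x#y⇒y-x#0 (u#1 n ℕ.≤-refl)))

  -- Two independent arguments stand for az and a/z: the shift z ↦ qz multiplies the first by q and
  -- divides the second by q, so the symmetry under z ↦ 1/z is lost in intermediate expressions.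
  Φ : ℕ → Carrier → Carrier → Carrier
  Φ k u v = poch u k * poch v k

  Φ-cong : ∀ k {u u′ v v′} → u ≈ u′ → v ≈ v′ → Φ k u v ≈ Φ k u′ v′
  Φ-cong k u≈ v≈ = *-cong (poch-cong k u≈) (poch-cong k v≈)

  Φ-suc : ∀ k u v → Φ (suc k) u v ≈ (1# - u * q ^ k) * (1# - v * q ^ k) * Φ k u v
  Φ-suc k u v = trans (*-cong (poch-snoc u k) (poch-snoc v k))
    (solve 4 (λ U x V y → U :* x :* (V :* y) := x :* y :* (U :* V)) refl _ _ _ _)

  -- Both sides are (u; q)_(k+1) (v; q)_k, with either the first or the last factor of (u; q)_(k+1)
  -- split off.
  Φ-shift : ∀ k u v → (1# - u) * Φ k (q * u) v ≈ (1# - u * q ^ k) * Φ k u v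
  Φ-shift k u v = begin
    (1# - u) * (poch (q * u) k * poch v k)     ≈⟨ *-assoc _ _ _ ⟨
    (1# - u) * poch (q * u) k * poch v k       ≈⟨ *-congʳ (trans (sym (poch-cons u k)) (poch-snoc u k)) ⟩
    poch u k * (1# - u * q ^ k) * poch v k     ≈⟨ solve 3 (λ U x V → U :* x :* V := x :* (U :* V)) refl _ _ _ ⟩
    (1# - u * q ^ k) * Φ k u v                 ∎

  -- Extends the ring solver by a relation s ≈ t: e is the cofactor of s - t.
  modulo : ∀ {s t} e {x y} → s ≈ t → x ≈ y + e * (s - t) → x ≈ y
  modulo {s} {t} e {x} {y} s≈t x≈ = begin
    x                 ≈⟨ x≈ ⟩
    y + e * (s - t)   ≈⟨ +-congˡ (*-congˡ (x≈y⇒x∙y⁻¹≈ε s≈t)) ⟩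
    y + e * 0#        ≈⟨ solve 2 (λ y e → y :+ e :* con (+ 0) := y) refl y e ⟩
    y                 ∎

  -- The two products share (qu; q)_k (v; q)_k. What is left is (1 - q^(k+1) u)(1 - v/q) - (1 - u)(1
  -- - q^k v), in which the terms in uv cancel.
  Φ-difference : ∀ {p} → q * p ≈ 1# → ∀ k u v →
    Φ (suc k) (q * u) (p * v) - Φ (suc k) u v ≈ (1# - q ^ suc k) * ((u - p * v) * Φ k (q * u) v)
  Φ-difference {p} qp≈1 k u v = begin
    Φ (suc k) (q * u) (p * v) - Φ (suc k) u v
      ≈⟨ +-cong (*-cong (poch-snoc (q * u) k) (trans (poch-cons (p * v) k) (*-congˡ (poch-cong k qpv≈v))))
                (-‿cong (*-cong (poch-cons u k) (poch-snoc v k))) ⟩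
    U * (1# - q * u * Q) * ((1# - p * v) * V) - (1# - u) * U * (V * (1# - v * Q))
      ≈⟨ modulo (U * V * Q * v * (u - 1#)) qp≈1 (solve 7 (λ q p u v U V Q →
           U :* (con (+ 1) :- q :* u :* Q) :* ((con (+ 1) :- p :* v) :* V) :- (con (+ 1) :- u) :* U :* (V :* (con (+ 1) :- v :* Q))
           := (con (+ 1) :- q :* Q) :* ((u :- p :* v) :* (U :* V)) :+ U :* V :* Q :* v :* (u :- con (+ 1)) :* (q :* p :- con (+ 1)))
           refl q p u v U V Q) ⟩
    (1# - q * Q) * ((u - p * v) * (U * V)) ∎
    where
    U = poch (q * u) k
    V = poch v k
    Q = q ^ k
    qpv≈v : q * (p * v) ≈ v
    qpv≈v = trans (sym (*-assoc _ _ _)) (trans (*-congʳ qp≈1) (*-identityˡ v))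

  module Basis (q#0 : q # 0#) (qᵐ#1 : ∀ m → q ^ suc m # 1#) where

    p : Carrier
    p = q ⁻¹

    qp≈1 : q * p ≈ 1#
    qp≈1 = ⁻¹-inverseʳ q#0

    p#0 : p # 0#
    p#0 = ⁻¹#0 q#0

    qz⁻¹ : ∀ {z} → z # 0# → (q * z) ⁻¹ ≈ p * z ⁻¹
    qz⁻¹ z#0 = sym (⁻¹-*-homo q#0 z#0)

    pz⁻¹ : ∀ {z} → z # 0# → (p * z) ⁻¹ ≈ q * z ⁻¹
    pz⁻¹ {z} z#0 = sym (xy≈1⇒y≈x⁻¹ (begin
      p * z * (q * z ⁻¹)     ≈⟨ solve 4 (λ p z q w → p :* z :* (q :* w) := q :* p :* (z :* w)) refl p z q _ ⟩
      q * p * (z * z ⁻¹)     ≈⟨ *-cong qp≈1 (⁻¹-inverseʳ z#0) ⟩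
      1# * 1#                ≈⟨ *-identityˡ 1# ⟩
      1#                     ∎))

    φ : Carrier → ℕ → Carrier → Carrier
    φ a k z = Φ k (a * z) (a * z ⁻¹)

    φ-top≈0 : ∀ {a} → a # 0# → ∀ {m g} → Below (φ a) m g → ∀ x →
      (∀ j → g (q ^ suc j) + x * φ a m (q ^ suc j) ≈ 0#) → x ≈ 0#
    φ-top≈0 {a} a#0 {m} b x g+xφ≈0 =
      vanishing⇒top≈0 {i = 0} (Below-map (λ k → Below-resp
          (λ z _ → trans (*-identityˡ _) (ψ₀≈φ k z)) (Below-ψ k 1#)) b) x
        (λ j → trans (+-congˡ (*-congˡ (ψ₀≈φ m (q ^ suc j)))) (g+xφ≈0 j))
      where
      -- By `Φ-difference` each q-difference leaves one more factor q on the argument az and none on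
      -- a/z, so these families are closed under it.
      ψ : ℕ → ℕ → Carrier → Carrier
      ψ i k z = Φ k (a * q ^ i * z) (a * z ⁻¹)
      d : ℕ → Carrier → Carrier
      d i z = a * q ^ i * z - p * (a * z ⁻¹)
      ψ₀≈φ : ∀ k z → ψ 0 k z ≈ φ a k z
      ψ₀≈φ k z = Φ-cong k (*-congʳ (*-identityʳ a)) refl
      ψ-suc : ∀ i k z → z # 0# →
        ψ i (suc k) (q * z) - ψ i (suc k) z ≈ (1# - q ^ suc k) * (d i z * ψ (suc i) k z)
      ψ-suc i k z z#0 = begin
        ψ i (suc k) (q * z) - ψ i (suc k) z
          ≈⟨ +-congʳ (Φ-cong (suc k)
               (solve 4 (λ a Q q z → a :* Q :* (q :* z) := q :* (a :* Q :* z)) refl a (q ^ i) q z)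
               (trans (*-congˡ (qz⁻¹ z#0)) (solve 3 (λ a p w → a :* (p :* w) := p :* (a :* w)) refl a p (z ⁻¹)))) ⟩
        Φ (suc k) (q * (a * q ^ i * z)) (p * (a * z ⁻¹)) - ψ i (suc k) z
          ≈⟨ Φ-difference qp≈1 k (a * q ^ i * z) (a * z ⁻¹) ⟩
        (1# - q ^ suc k) * (d i z * Φ k (q * (a * q ^ i * z)) (a * z ⁻¹))
          ≈⟨ *-congˡ (*-congˡ (Φ-cong k (solve 4 (λ a Q q z → q :* (a :* Q :* z) := a :* (q :* Q) :* z) refl a (q ^ i) q z) refl)) ⟩
        (1# - q ^ suc k) * (d i z * ψ (suc i) k z) ∎
      d#0 : ∀ i j → d i (q ^ suc j) # 0#
      -- Multiplied by qz, the factor becomes a (q^(i+1) z² - 1), which at z = q^(j+1) is a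
      -- (q^(i+2j+3) - 1).
      d#0 i j = *-#0⇒#0ˡ (#-congʳ (sym dqz≈) (*-#0 a#0 (x#y⇒x-y#0 (qᵐ#1 (i ℕ.+ (suc j ℕ.+ suc j))))))
        where
        z = q ^ suc j
        dqz≈ : d i z * (q * z) ≈ a * (q ^ suc (i ℕ.+ (suc j ℕ.+ suc j)) - 1#)
        dqz≈ = begin
          (a * q ^ i * z - p * (a * z ⁻¹)) * (q * z)
            ≈⟨ solve 6 (λ a Q z p w q → (a :* Q :* z :- p :* (a :* w)) :* (q :* z)
                 := a :* (q :* (Q :* (z :* z)) :- (q :* p) :* (z :* w))) refl a (q ^ i) z p (z ⁻¹) q ⟩
          a * (q * (q ^ i * (z * z)) - q * p * (z * z ⁻¹))
            ≈⟨ *-congˡ (+-cong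
                 (*-congˡ (sym (trans (^-homo-* q i (suc j ℕ.+ suc j)) (*-congˡ (^-homo-* q (suc j) (suc j))))))
                 (-‿cong (trans (*-cong qp≈1 (⁻¹-inverseʳ (^-#0 q#0 (suc j)))) (*-identityˡ 1#)))) ⟩
          a * (q ^ suc (i ℕ.+ (suc j ℕ.+ suc j)) - 1#) ∎
      open Lowering q q#0 qᵐ#1 ψ d (λ i z → *-identityˡ 1#) ψ-suc d#0

    φ-suc : ∀ a k z → φ a (suc k) z ≈ (1# - a * q ^ k * z) * (1# - a * q ^ k * z ⁻¹) * φ a k z
    φ-suc a k z = trans (Φ-suc k (a * z) (a * z ⁻¹))
      (solve 5 (λ a z w Q P → (con (+ 1) :- a :* z :* Q) :* (con (+ 1) :- a :* w :* Q) :* P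
        := (con (+ 1) :- a :* Q :* z) :* (con (+ 1) :- a :* Q :* w) :* P) refl a z (z ⁻¹) (q ^ k) _)

    module _ {a} (a#0 : a # 0#) where

      -- Both (1 - sz)(1 - s/z) and (1 - tz)(1 - t/z) are linear in z + 1/z, with slopes -s and -t.
      -- Eliminating z + 1/z produces β, and the product with t raises φₖ to φₖ₊₁.
      φ-quadratic : ∀ s k → let t = a * q ^ k ; β = s / t in
        (λ z → (1# - s * z) * (1# - s * z ⁻¹) * φ a k z) ≐
        (λ z → (1# + s * s - β * (1# + t * t)) * φ a k z + β * φ a (suc k) z)
      φ-quadratic s k z z#0 = begin
        (1# - s * z) * (1# - s * w) * P
          ≈⟨ modulo (s * s * P) zw≈1 (solve 4 (λ s z w P → (con (+ 1) :- s :* z) :* (con (+ 1) :- s :* w) :* P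
               := (con (+ 1) :+ s :* s :- s :* (z :+ w)) :* P :+ s :* s :* P :* (z :* w :- con (+ 1))) refl s z w P) ⟩
        (1# + s * s - s * (z + w)) * P
          ≈⟨ modulo (- (s * (z + w) * P)) it≈1 (solve 6 (λ s z w P t i → (con (+ 1) :+ s :* s :- s :* (z :+ w)) :* P
               := (con (+ 1) :+ s :* s :- (s :* i) :* (t :* (z :+ w))) :* P :+ (:- (s :* (z :+ w) :* P)) :* (con (+ 1) :- i :* t)) refl s z w P t i) ⟩
        (1# + s * s - β * (t * (z + w))) * P
          ≈⟨ modulo (β * t * t * P) (sym zw≈1) (solve 6 (λ s z w P t b → (con (+ 1) :+ s :* s :- b :* (t :* (z :+ w))) :* P
               := (con (+ 1) :+ s :* s :- b :* (con (+ 1) :+ t :* t)) :* P :+ b :* ((con (+ 1) :- t :* z) :* (con (+ 1) :- t :* w) :* P)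
                 :+ b :* t :* t :* P :* (con (+ 1) :- z :* w)) refl s z w P t β) ⟩
        (1# + s * s - β * (1# + t * t)) * P + β * ((1# - t * z) * (1# - t * w) * P)
          ≈⟨ +-congˡ (*-congˡ (φ-suc a k z)) ⟨
        (1# + s * s - β * (1# + t * t)) * P + β * φ a (suc k) z ∎
        where
        w = z ⁻¹
        t = a * q ^ k
        i = t ⁻¹
        β = s / t
        P = φ a k z
        zw≈1 : z * w ≈ 1#
        zw≈1 = ⁻¹-inverseʳ z#0
        it≈1 : 1# ≈ i * t
        it≈1 = sym (⁻¹-inverseˡ (*-#0 a#0 (^-#0 q#0 k)))

      Below-quadratic : ∀ s {m f} → Below (φ a) m f →
        Below (φ a) (suc m) (λ z → (1# - s * z) * (1# - s * z ⁻¹) * f z)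
      Below-quadratic s (none f≐0) =
        Below-resp (λ z z#0 → sym (trans (*-congˡ (f≐0 z z#0)) (zeroʳ _))) (Below-0 1)
      Below-quadratic s (adjoin {m = m} {f = f} {g = g} b x f≐) = Below-resp
        (λ z z#0 → sym (trans (*-congˡ (f≐ z z#0)) (trans
          (solve 4 (λ r g x p → r :* (g :+ x :* p) := r :* g :+ x :* (r :* p)) refl _ (g z) x (φ a m z))
          (+-congˡ (*-congˡ (φ-quadratic s m z z#0))))))
        (Below-+ (Below-suc (Below-quadratic s b))
          (Below-* x (Below-+ (Below-suc (Below-ψ m _)) (Below-ψ (suc m) _))))

      -- Each new factor on the b side is expanded by `φ-quadratic` with s = bq^j and t = aq^j, so β
      -- = b/a at every step and κ = (b/a)^j. The last component says so without division.
      φ-rebase : ∀ b j → ∃ λ κ → ∃ λ g → Below (φ a) j g ×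
        φ b j ≐ (λ z → g z + κ * φ a j z) × κ * a ^ j ≈ b ^ j
      φ-rebase b zero = 1# , (λ _ → 0#) , Below-0 0 ,
        (λ z _ → solve 1 (λ x → x := con (+ 0) :+ con (+ 1) :* x) refl (1# * 1#)) , *-identityˡ 1#
      φ-rebase b (suc j) with φ-rebase b j
      ... | κ , g , g< , φb≐ , κa≈b = κ * β , _ ,
        Below-+ (Below-quadratic s g<) (Below-ψ j (κ * α)) , (λ z z#0 → begin
          φ b (suc j) z                                                ≈⟨ φ-suc b j z ⟩
          (1# - s * z) * (1# - s * z ⁻¹) * φ b j z                     ≈⟨ *-congˡ (φb≐ z z#0) ⟩
          (1# - s * z) * (1# - s * z ⁻¹) * (g z + κ * φ a j z)
            ≈⟨ solve 4 (λ r g x p → r :* (g :+ x :* p) := r :* g :+ x :* (r :* p)) refl _ (g z) κ (φ a j z) ⟩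
          (1# - s * z) * (1# - s * z ⁻¹) * g z + κ * ((1# - s * z) * (1# - s * z ⁻¹) * φ a j z)
            ≈⟨ +-congˡ (*-congˡ (φ-quadratic s j z z#0)) ⟩
          (1# - s * z) * (1# - s * z ⁻¹) * g z + κ * (α * φ a j z + β * φ a (suc j) z)
            ≈⟨ solve 6 (λ h k x p y r → h :+ k :* (x :* p :+ y :* r) := h :+ k :* x :* p :+ k :* y :* r) refl _ κ α _ β _ ⟩
          (1# - s * z) * (1# - s * z ⁻¹) * g z + κ * α * φ a j z + κ * β * φ a (suc j) z ∎) ,
        (begin
          κ * (b * Q * i) * (a * a ^ j)
            ≈⟨ solve 6 (λ k b Q i a A → k :* (b :* Q :* i) :* (a :* A) := b :* (k :* A) :* (a :* Q :* i)) refl κ b Q i a (a ^ j) ⟩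
          b * (κ * a ^ j) * (t * i)
            ≈⟨ *-cong (*-congˡ κa≈b) (⁻¹-inverseʳ (*-#0 a#0 (^-#0 q#0 j))) ⟩
          b * b ^ j * 1#      ≈⟨ *-identityʳ _ ⟩
          b ^ suc j           ∎)
        where
        Q = q ^ j
        s = b * Q
        t = a * Q
        i = t ⁻¹
        β = s / t
        α = 1# + s * s - β * (1# + t * t)

      Below-rebase : ∀ b {m f} → Below (φ b) m f → Below (φ a) m f
      Below-rebase b = Below-map λ k →
        let κ , g , g< , φb≐ , _ = φ-rebase b k in
        Below-resp (λ z z#0 → sym (φb≐ z z#0)) (Below-+ (Below-suc g<) (Below-ψ k κ))

-- The Askey-Wilson operator

module Operator
  {c ℓ₁ ℓ₂} (F : HeytingField c ℓ₁ ℓ₂)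
  (_#?_ : Decidable (HeytingField._#_ F))
  (q : HeytingField.Carrier F)
  (q#0 : HeytingField._#_ F q (HeytingField.0# F))
  (qᵐ#1 : ∀ m → HeytingField._#_ F (AskeyWilson._^_ F _#?_ q (suc m)) (HeytingField.1# F))
  where

  open HeytingField F
  open AskeyWilson F _#?_ hiding (poch; φ)
  open Field F _#?_
  open Pochhammer F _#?_ q
  open Basis q#0 qᵐ#1
  open import Relation.Binary.Reasoning.Setoid setoid

  pⁿqⁿ≈1 : ∀ n → p ^ n * q ^ n ≈ 1#
  pⁿqⁿ≈1 zero    = *-identityˡ 1#
  pⁿqⁿ≈1 (suc n) = begin
    p * p ^ n * (q * q ^ n)     ≈⟨ solve 4 (λ p P q Q → p :* P :* (q :* Q) := q :* p :* (P :* Q)) refl p _ q _ ⟩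
    q * p * (p ^ n * q ^ n)     ≈⟨ *-cong qp≈1 (pⁿqⁿ≈1 n) ⟩
    1# * 1#                     ≈⟨ *-identityˡ 1# ⟩
    1#                          ∎

  W : Carrier → Carrier
  W z = (1# - z * z) * (1# - q * (z * z)) * (q - z * z)

  -- At z = q^(j+1) the factors of W are 1 - q^(2j+2), 1 - q^(2j+3) and q (1 - q^(2j+1)).
  W#0 : ∀ j → W (q ^ suc j) # 0#
  W#0 j = *-#0 (*-#0 (x#y⇒y-x#0 z²#1) (x#y⇒y-x#0 qz²#1)) (#-congʳ (sym q-z²≈) (*-#0 q#0 (x#y⇒y-x#0 (qᵐ#1 (j ℕ.+ j)))))
    where
    z = q ^ suc j
    z²≈ : z * z ≈ q ^ suc (j ℕ.+ suc j)
    z²≈ = sym (^-homo-* q (suc j) (suc j))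
    z²#1 : z * z # 1#
    z²#1 = #-congʳ (sym z²≈) (qᵐ#1 (j ℕ.+ suc j))
    qz²#1 : q * (z * z) # 1#
    qz²#1 = #-congʳ (sym (*-congˡ z²≈)) (qᵐ#1 (suc (j ℕ.+ suc j)))
    q-z²≈ : q - z * z ≈ q * (1# - q * q ^ (j ℕ.+ j))
    q-z²≈ = trans (solve 2 (λ q Q → q :- q :* Q :* (q :* Q) := q :* (con (+ 1) :- q :* (Q :* Q))) refl q (q ^ j))
      (*-congˡ (+-congˡ (-‿cong (*-congˡ (sym (^-homo-* q j j))))))

  module _ (a : Vector Carrier 4) where

    -- D is W times the Askey–Wilson operator
    --   A(z) (f(qz) - f(z)) + A(z⁻¹) (f(z/q) - f(z)),  A(z) = B(z) / ((1 - z²)(1 - qz²)),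
    -- so that it has no poles; B* z = z⁴ B(z⁻¹).
    B B* : Carrier → Carrier
    B  z = product {4} (λ i → 1# - a i * z)
    B* z = product {4} (λ i → z - a i)

    D : (Carrier → Carrier) → Carrier → Carrier
    D f z = (q - z * z) * B z * (f (q * z) - f z) + (1# - q * (z * z)) * B* z * (f (p * z) - f z)

    E : Carrier
    E = product a * p

    -- D φₖ₊₁ = W (λₖ₊₁ φₖ₊₁ - μₖ φₖ).
    λ′ μ′ : ℕ → Carrier
    λ′ k = (p ^ k - 1#) * (1# - E * q ^ k)
    μ′ k = p * p ^ k * ((1# - q * q ^ k) * ((1# - a 0F * a 1F * q ^ k)
             * ((1# - a 0F * a 2F * q ^ k) * (1# - a 0F * a 3F * q ^ k))))

    -- Expanded, λₖ = q^(-k) + E q^k - (1 + E), and q^k - q^n = -(q^(-k) - q^(-n)) q^(k+n). The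
    -- factored form serves twice: it separates the eigenvalues, and it matches the ratio of
    -- consecutive coefficients of the ₄φ₃.
    λ′-difference : ∀ k n → λ′ k - λ′ n ≈ (p ^ k - p ^ n) * (1# - E * q ^ k * q ^ n)
    λ′-difference k n = modulo (E * q ^ n - E) (pⁿqⁿ≈1 k) (trans
       (modulo (E - E * q ^ k) (pⁿqⁿ≈1 n) (solve 5 (λ P Q P′ Q′ E →
          (P :- con (+ 1)) :* (con (+ 1) :- E :* Q) :- (P′ :- con (+ 1)) :* (con (+ 1) :- E :* Q′)
          := (P :- P′) :* (con (+ 1) :- E :* Q :* Q′) :+ (E :* Q′ :- E) :* (P :* Q :- con (+ 1))
             :+ (E :- E :* Q) :* (P′ :* Q′ :- con (+ 1))) refl (p ^ k) (q ^ k) (p ^ n) (q ^ n) E)) refl)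

    D-cong : ∀ {f g} → f ≐ g → D f ≐ D g
    D-cong f≐g z z#0 = +-cong (*-congˡ (+-cong (f≐g _ (*-#0 q#0 z#0)) (-‿cong (f≐g z z#0))))
                              (*-congˡ (+-cong (f≐g _ (*-#0 p#0 z#0)) (-‿cong (f≐g z z#0))))

    D-linear : ∀ f g x z → D (λ z → f z + x * g z) z ≈ D f z + x * D g z
    D-linear f g x z = solve 9 (λ u v f f′ f″ g g′ g″ x →
        u :* (f′ :+ x :* g′ :- (f :+ x :* g)) :+ v :* (f″ :+ x :* g″ :- (f :+ x :* g))
        := u :* (f′ :- f) :+ v :* (f″ :- f) :+ x :* (u :* (g′ :- g) :+ v :* (g″ :- g)))
      refl _ _ (f z) (f (q * z)) (f (p * z)) (g z) (g (q * z)) (g (p * z)) x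

    D-const : ∀ x z → D (λ _ → x) z ≈ 0#
    D-const x z = solve 3 (λ u v x → u :* (x :- x) :+ v :* (x :- x) := con (+ 0)) refl _ _ x

    D-zero : ∀ {f} → f ≐ (λ _ → 0#) → D f ≐ (λ _ → 0#)
    D-zero f≐0 z z#0 = trans (D-cong f≐0 z z#0) (D-const 0# z)

    -- Π (z - tᵢ) - Π (1 - tᵢ z) for four parameters is antisymmetric under z ↦ z⁻¹
    -- up to z⁴, hence divisible by 1 - z².
    quartic-difference : ∀ b c d s z →
      (z - b) * ((z - c) * (z - d)) * (z - s)
        - (1# - b * z) * ((1# - c * z) * (1# - d * z)) * (1# - s * z)
      ≈ - (1# - z * z) * ((1# - s * (b * (c * d))) * (1# + z * z)
          - (s + b + c + d - (b * c * d + s * (b * c + b * d + c * d))) * z)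
    quartic-difference = solve 5 (λ b c d s z →
      (z :- b) :* ((z :- c) :* (z :- d)) :* (z :- s)
        :- (con (+ 1) :- b :* z) :* ((con (+ 1) :- c :* z) :* (con (+ 1) :- d :* z)) :* (con (+ 1) :- s :* z)
      := :- (con (+ 1) :- z :* z) :* ((con (+ 1) :- s :* (b :* (c :* d))) :* (con (+ 1) :+ z :* z)
          :- (s :+ b :+ c :+ d :- (b :* c :* d :+ s :* (b :* c :+ b :* d :+ c :* d))) :* z)) refl

    -- Both sides are linear in z + w, and the bracket is the one in `quartic-difference`. With s =
    -- aq^j that identity describes the operator side and this one the side of `λ′` and `μ′`, so the
    -- two meet in the bracket.
    raising-identity : ∀ b c d s z w → z * w ≈ 1# →
      (1# - s * (b * (c * d))) * ((1# - s * z) * (1# - s * w))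
        - (1# - s * b) * ((1# - s * c) * (1# - s * d))
      ≈ - s * (w * ((1# - s * (b * (c * d))) * (1# + z * z)
          - (s + b + c + d - (b * c * d + s * (b * c + b * d + c * d))) * z))
    raising-identity b c d s z w zw≈1 = modulo
      (s * s * (1# - s * (b * (c * d))) + s * ((1# - s * (b * (c * d))) * z
         - (s + b + c + d - (b * c * d + s * (b * c + b * d + c * d))))) zw≈1
      (solve 6 (λ b c d s z w →
      (con (+ 1) :- s :* (b :* (c :* d))) :* ((con (+ 1) :- s :* z) :* (con (+ 1) :- s :* w))
        :- (con (+ 1) :- s :* b) :* ((con (+ 1) :- s :* c) :* (con (+ 1) :- s :* d))
      := :- s :* (w :* ((con (+ 1) :- s :* (b :* (c :* d))) :* (con (+ 1) :+ z :* z)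
          :- (s :+ b :+ c :+ d :- (b :* c :* d :+ s :* (b :* c :+ b :* d :+ c :* d))) :* z))
        :+ (s :* s :* (con (+ 1) :- s :* (b :* (c :* d))) :+ s :* ((con (+ 1) :- s :* (b :* (c :* d))) :* z
         :- (s :+ b :+ c :+ d :- (b :* c :* d :+ s :* (b :* c :+ b :* d :+ c :* d))))) :* (z :* w :- con (+ 1))) refl b c d s z w)

    -- `Φ-difference` gives either difference the factor 1 - qz² or q - z², whichever its
    -- coefficient lacks. `Φ-shift` turns the factor 1 - az of B into 1 - aq^j z, and z - a of B*
    -- into z - aq^j. What remains is a quartic difference with a replaced by aq^j, and it supplies
    -- the last factor 1 - z² of W.
    D-φ-suc : ∀ j z → z # 0# →
      D (φ (a 0F) (suc j)) z ≈ W z * (λ′ (suc j) * φ (a 0F) (suc j) z - μ′ j * φ (a 0F) j z)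
    D-φ-suc j z z#0 = trans lhs (sym rhs)
      where
      α = a 0F
      b = a 1F
      c′ = a 2F
      d = a 3F
      w = z ⁻¹
      Q = q ^ j
      P = p ^ j
      s = α * Q
      X = α * z
      Y = α * w
      G = φ α j z
      e = s * (b * (c′ * d))
      zw≈1 : z * w ≈ 1#
      zw≈1 = ⁻¹-inverseʳ z#0
      B₃  = (1# - b * z) * ((1# - c′ * z) * (1# - d * z))
      B*₃ = (z - b) * ((z - c′) * (z - d))
      M  = Φ j (q * X) Y
      M* = Φ j (q * Y) X
      K = (1# - e) * (1# + z * z) - (s + b + c′ + d - (b * c′ * d + s * (b * c′ + b * d + c′ * d))) * z
      common = (1# - q * Q) * G

      X-pY≈ : X - p * Y ≈ - (α * p * w) * (1# - q * (z * z))
      X-pY≈ = modulo (- (X * (z * w))) qp≈1 (trans (modulo (- X) zw≈1 (solve 5 (λ α z w p q →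
        α :* z :- p :* (α :* w) := :- (α :* p :* w) :* (con (+ 1) :- q :* (z :* z)) :+ (:- (α :* z :* (z :* w))) :* (q :* p :- con (+ 1))
          :+ (:- (α :* z)) :* (z :* w :- con (+ 1))) refl α z w p q)) refl)

      Y-pX≈ : Y - p * X ≈ α * p * w * (q - z * z)
      Y-pX≈ = modulo (- Y) qp≈1 (modulo (p * X) zw≈1 (solve 5 (λ α z w p q →
        α :* w :- p :* (α :* z) := α :* p :* w :* (q :- z :* z) :+ (:- (α :* w)) :* (q :* p :- con (+ 1))
          :+ p :* (α :* z) :* (z :* w :- con (+ 1))) refl α z w p q))

      first : (q - z * z) * B z * (φ α (suc j) (q * z) - φ α (suc j) z) ≈
              - (common * (α * p * w) * ((q - z * z) * (1# - q * (z * z))) * (B₃ * (1# - s * z)))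
      first = begin
        (q - z * z) * B z * (φ α (suc j) (q * z) - φ α (suc j) z)
          ≈⟨ *-congˡ (trans (+-congʳ (Φ-cong (suc j)
               (solve 3 (λ α q z → α :* (q :* z) := q :* (α :* z)) refl α q z)
               (trans (*-congˡ (qz⁻¹ z#0)) (solve 3 (λ α p w → α :* (p :* w) := p :* (α :* w)) refl α p w))))
               (Φ-difference qp≈1 j X Y)) ⟩
        (q - z * z) * B z * ((1# - q * Q) * ((X - p * Y) * M))
          ≈⟨ solve 8 (λ u x b c d v r m → u :* (x :* (b :* (c :* (d :* con (+ 1))))) :* (v :* (r :* m))
               := u :* (b :* (c :* d)) :* v :* r :* (x :* m)) refl _ (1# - X) _ _ _ _ _ M ⟩
        (q - z * z) * B₃ * (1# - q * Q) * (X - p * Y) * ((1# - X) * M)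
          ≈⟨ *-cong (*-congˡ X-pY≈) (Φ-shift j X Y) ⟩
        (q - z * z) * B₃ * (1# - q * Q) * (- (α * p * w) * (1# - q * (z * z))) * ((1# - X * Q) * G)
          ≈⟨ solve 9 (λ u b v r y α z Q G → u :* b :* v :* (:- r :* y) :* ((con (+ 1) :- α :* z :* Q) :* G)
               := :- (v :* G :* r :* (u :* y) :* (b :* (con (+ 1) :- α :* Q :* z)))) refl _ B₃ _ _ _ α z Q G ⟩
        - (common * (α * p * w) * ((q - z * z) * (1# - q * (z * z))) * (B₃ * (1# - s * z))) ∎

      second : (1# - q * (z * z)) * B* z * (φ α (suc j) (p * z) - φ α (suc j) z) ≈
               common * (α * p * w) * ((q - z * z) * (1# - q * (z * z))) * (B*₃ * (z - s))
      second = begin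
        (1# - q * (z * z)) * B* z * (φ α (suc j) (p * z) - φ α (suc j) z)
          -- The shift z ↦ z/q multiplies a/z by q, so `X` and `Y` exchange the roles they have in
          -- `first`.
          ≈⟨ *-congˡ (trans (+-cong (trans (*-comm _ _) (Φ-cong (suc j)
               (trans (*-congˡ (pz⁻¹ z#0)) (solve 3 (λ α q w → α :* (q :* w) := q :* (α :* w)) refl α q w))
               (solve 3 (λ α p z → α :* (p :* z) := p :* (α :* z)) refl α p z))) (-‿cong (*-comm _ _)))
               (Φ-difference qp≈1 j Y X)) ⟩
        (1# - q * (z * z)) * B* z * ((1# - q * Q) * ((Y - p * X) * M*))
          ≈⟨ modulo (α * ((1# - q * (z * z)) * B*₃ * (1# - q * Q) * (Y - p * X)) * M*) zw≈1
             (solve 10 (λ u z α w b c d v r m → u :* ((z :- α) :* (b :* (c :* (d :* con (+ 1))))) :* (v :* (r :* m))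
               := u :* (b :* (c :* d)) :* v :* r :* z :* ((con (+ 1) :- α :* w) :* m)
                 :+ α :* (u :* (b :* (c :* d)) :* v :* r) :* m :* (z :* w :- con (+ 1))) refl _ z α w _ _ _ _ _ M*) ⟩
        (1# - q * (z * z)) * B*₃ * (1# - q * Q) * (Y - p * X) * z * ((1# - Y) * M*)
          ≈⟨ *-cong (*-congʳ (*-congˡ Y-pX≈)) (trans (Φ-shift j Y X) (*-congˡ (*-comm _ _))) ⟩
        (1# - q * (z * z)) * B*₃ * (1# - q * Q) * (α * p * w * (q - z * z)) * z * ((1# - Y * Q) * G)
          ≈⟨ modulo (- (s * ((1# - q * (z * z)) * B*₃ * (1# - q * Q) * (α * p * w * (q - z * z))) * G)) zw≈1
             (solve 10 (λ u b v r y α z w Q G → u :* b :* v :* (r :* y) :* z :* ((con (+ 1) :- α :* w :* Q) :* G)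
               := v :* G :* r :* (y :* u) :* (b :* (z :- α :* Q))
                 :+ (:- (α :* Q :* (u :* b :* v :* (r :* y)) :* G)) :* (z :* w :- con (+ 1))) refl _ B*₃ _ _ _ α z w Q G) ⟩
        common * (α * p * w) * ((q - z * z) * (1# - q * (z * z))) * (B*₃ * (z - s)) ∎

      lhs : D (φ α (suc j)) z ≈ - (W z * (common * (α * p) * (w * K)))
      lhs = begin
        D (φ α (suc j)) z
          ≈⟨ +-cong first second ⟩
        - (common * (α * p * w) * V * (B₃ * (1# - s * z))) + common * (α * p * w) * V * (B*₃ * (z - s))
          ≈⟨ solve 3 (λ x y y′ → :- (x :* y) :+ x :* y′ := x :* (y′ :- y)) refl _ (B₃ * (1# - s * z)) (B*₃ * (z - s)) ⟩
        common * (α * p * w) * V * (B*₃ * (z - s) - B₃ * (1# - s * z))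
          ≈⟨ *-congˡ (quartic-difference b c′ d s z) ⟩
        common * (α * p * w) * V * (- (1# - z * z) * K)
          ≈⟨ solve 7 (λ x y w u v t K → x :* (y :* w) :* (u :* v) :* (:- t :* K)
               := :- (t :* v :* u :* (x :* y :* (w :* K)))) refl common (α * p) w _ _ (1# - z * z) K ⟩
        - (W z * (common * (α * p) * (w * K))) ∎
        where V = (q - z * z) * (1# - q * (z * z))

      λ′≈ : λ′ (suc j) ≈ p * P * (1# - q * Q) * (1# - e)
      λ′≈ = begin
        (p * P - 1#) * (1# - product a * p * (q * Q))
          ≈⟨ *-cong (modulo 1# (pⁿqⁿ≈1 (suc j)) (solve 2 (λ x y → x :- con (+ 1)
               := x :* (con (+ 1) :- y) :+ con (+ 1) :* (x :* y :- con (+ 1))) refl (p * P) (q * Q)))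
             (+-congˡ (-‿cong (modulo e qp≈1 (solve 7 (λ a b c d p q Q →
               a :* (b :* (c :* (d :* con (+ 1)))) :* p :* (q :* Q) := a :* Q :* (b :* (c :* d)) :+ a :* Q :* (b :* (c :* d)) :* (q :* p :- con (+ 1)))
               refl α b c′ d p q Q)))) ⟩
        p * P * (1# - q * Q) * (1# - e) ∎

      rhs : W z * (λ′ (suc j) * φ α (suc j) z - μ′ j * G) ≈ - (W z * (common * (α * p) * (w * K)))
      rhs = begin
        W z * (λ′ (suc j) * φ α (suc j) z - μ′ j * G)
          ≈⟨ *-congˡ (+-cong (*-cong λ′≈ (φ-suc α j z)) (-‿cong (*-congʳ (*-congˡ (*-congˡ (*-cong (flip b) (*-cong (flip c′) (flip d)))))))) ⟩
        W z * (p * P * (1# - q * Q) * (1# - e) * ((1# - s * z) * (1# - s * w) * G)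
          - p * P * ((1# - q * Q) * ((1# - s * b) * ((1# - s * c′) * (1# - s * d)))) * G)
          ≈⟨ *-congˡ (solve 6 (λ x u v y t G → x :* u :* v :* (y :* G) :- x :* (u :* t) :* G
               := x :* (u :* G) :* (v :* y :- t)) refl (p * P) _ (1# - e) _ _ G) ⟩
        W z * (p * P * common * ((1# - e) * ((1# - s * z) * (1# - s * w)) - (1# - s * b) * ((1# - s * c′) * (1# - s * d))))
          ≈⟨ *-congˡ (*-congˡ (raising-identity b c′ d s z w zw≈1)) ⟩
        W z * (p * P * common * (- s * (w * K)))
          ≈⟨ modulo (- (W z * (common * (α * p) * (w * K)))) (pⁿqⁿ≈1 j) (solve 7 (λ W p P C α Q K →
               W :* (p :* P :* C :* (:- (α :* Q) :* K)) := :- (W :* (C :* (α :* p) :* K))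
                 :+ (:- (W :* (C :* (α :* p) :* K))) :* (P :* Q :- con (+ 1))) refl (W z) p P common α Q (w * K)) ⟩
        - (W z * (common * (α * p) * (w * K))) ∎
        where
        flip : ∀ x → 1# - α * x * Q ≈ 1# - s * x
        flip x = solve 3 (λ α x Q → con (+ 1) :- α :* x :* Q := con (+ 1) :- α :* Q :* x) refl α x Q

    D-φ : ∀ k → ∃ λ ℓ → Below (φ (a 0F)) k ℓ × D (φ (a 0F) k) ≐ (λ z → W z * (ℓ z + λ′ k * φ (a 0F) k z))
    D-φ zero = (λ _ → 0#) , Below-0 0 , λ z _ → trans (D-const (1# * 1#) z)
      (solve 2 (λ W e → con (+ 0) := W :* (con (+ 0) :+ (con (+ 1) :- con (+ 1)) :* e :* (con (+ 1) :* con (+ 1)))) refl (W z) (1# - E * 1#))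
    D-φ (suc j) = _ , Below-ψ j (- μ′ j) , λ z z#0 → trans (D-φ-suc j z z#0)
      (*-congˡ (solve 4 (λ l f m g → l :* f :- m :* g := :- m :* g :+ l :* f) refl (λ′ (suc j)) _ (μ′ j) _))

    D-Below : ∀ {m f} → Below (φ (a 0F)) m f →
      ∃ λ h → Below (φ (a 0F)) m h × D f ≐ (λ z → W z * h z)
    D-Below (none f≐0) = (λ _ → 0#) , Below-0 0 , λ z z#0 → trans (D-zero f≐0 z z#0) (sym (zeroʳ _))
    D-Below (adjoin {m = m} {g = g} b x f≐) =
      let h , h< , Dg≐ = D-Below b
          ℓ , ℓ< , Dφ≐ = D-φ m
      in (λ z → h z + x * (ℓ z + λ′ m * φ (a 0F) m z)) ,
         Below-+ (Below-suc h<) (Below-* x (Below-+ (Below-suc ℓ<) (Below-ψ m (λ′ m)))) ,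
         λ z z#0 → trans (D-cong f≐ z z#0) (trans (D-linear g (φ (a 0F) m) x z)
           (trans (+-cong (Dg≐ z z#0) (*-congˡ (Dφ≐ z z#0)))
             (solve 4 (λ W h x t → W :* h :+ x :* (W :* t) := W :* (h :+ x :* t)) refl (W z) (h z) x _)))

    -- Comparing the coefficients of φₘ at the points q^(j+1), where W cancels, gives x (λₘ - λₙ) =
    -- 0. As m < n, the top term drops out and the argument descends to g.
    eigenfunction-Below⇒≈0 : a 0F # 0# → ∀ n → (∀ k → k < n → λ′ k - λ′ n # 0#) →
      ∀ {m f} → m ≤ n → Below (φ (a 0F)) m f → D f ≐ (λ z → W z * (λ′ n * f z)) → f ≐ (λ _ → 0#)
    eigenfunction-Below⇒≈0 a#0 n λ#0 m≤n (none f≐0) Df≐ = f≐0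
    eigenfunction-Below⇒≈0 a#0 n λ#0 m<n (adjoin {m = m} {f = f} {g = g} b x f≐) Df≐ =
      let h , h< , Dg≐ = D-Below b
          ℓ , ℓ< , Dφ≐ = D-φ m
          ψ = φ (a 0F) m
          x≈0 : x ≈ 0#
          x≈0 = xy≈0⇒x≈0 (λ#0 m m<n) (φ-top≈0 a#0
            (Below-+ (Below-+ h< (Below-* x ℓ<)) (Below-* (- λ′ n) b)) (x * (λ′ m - λ′ n)) λ j →
            let z = q ^ suc j ; z#0 = ^-#0 q#0 (suc j) in xy≈0⇒y≈0 (W#0 j) (begin
            W z * (h z + x * ℓ z + - λ′ n * g z + x * (λ′ m - λ′ n) * ψ z)
              ≈⟨ solve 8 (λ W h x ℓ l g l′ f → W :* (h :+ x :* ℓ :+ :- l :* g :+ x :* (l′ :- l) :* f)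
                   := W :* h :+ x :* (W :* (ℓ :+ l′ :* f)) :- W :* (l :* (g :+ x :* f))) refl (W z) (h z) x (ℓ z) (λ′ n) (g z) (λ′ m) (ψ z) ⟩
            W z * h z + x * (W z * (ℓ z + λ′ m * ψ z)) - W z * (λ′ n * (g z + x * ψ z))
              ≈⟨ +-cong (+-cong (Dg≐ z z#0) (*-congˡ (Dφ≐ z z#0))) (-‿cong (*-congˡ (*-congˡ (f≐ z z#0)))) ⟨
            D g z + x * D ψ z - W z * (λ′ n * f z)
              ≈⟨ +-congʳ (D-linear g ψ x z) ⟨
            D (λ z → g z + x * ψ z) z - W z * (λ′ n * f z)
              ≈⟨ x≈y⇒x∙y⁻¹≈ε (trans (sym (D-cong f≐ z z#0)) (Df≐ z z#0)) ⟩
            0# ∎))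
          f≐g : f ≐ g
          f≐g z z#0 = trans (f≐ z z#0) (trans (+-congˡ (x≈0⇒x*y≈0 x≈0)) (+-identityʳ _))
      in λ z z#0 → trans (f≐g z z#0) (eigenfunction-Below⇒≈0 a#0 n λ#0 (ℕ.<⇒≤ m<n) b
           (λ z z#0 → trans (sym (D-cong f≐g z z#0)) (trans (Df≐ z z#0) (*-congˡ (*-congˡ (f≐g z z#0))))) z z#0)

-- Askey-Wilson polynomials as eigenfunctions, and their symmetry

module AWPolynomials
  {c ℓ₁ ℓ₂} (F : HeytingField c ℓ₁ ℓ₂)
  (_#?_ : Decidable (HeytingField._#_ F))
  (2#0 : HeytingField._#_ F (AskeyWilson.2# F _#?_) (HeytingField.0# F))
  (q : HeytingField.Carrier F)
  (q#0 : HeytingField._#_ F q (HeytingField.0# F))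
  (qᵐ#1 : ∀ m → HeytingField._#_ F (AskeyWilson._^_ F _#?_ q (suc m)) (HeytingField.1# F))
  where

  open HeytingField F
  open AskeyWilson F _#?_ hiding (poch; φ)
  open Field F _#?_
  open Pochhammer F _#?_ q
  open Basis q#0 qᵐ#1
  open Operator F _#?_ q q#0 qᵐ#1
  open import Relation.Binary.Reasoning.Setoid setoid

  q⁻ⁿ : ℕ → Carrier
  q⁻ⁿ n = q ^ᶻ (ℤ.- (+ n))

  q⁻ⁿ≈pⁿ : ∀ n → q⁻ⁿ n ≈ p ^ n
  q⁻ⁿ≈pⁿ zero    = refl
  q⁻ⁿ≈pⁿ (suc n) = sym (xy≈1⇒y≈x⁻¹ (trans (*-comm _ _) (pⁿqⁿ≈1 (suc n))))

  pᵏ-pⁿ#0 : ∀ k m → p ^ k - p ^ suc (k ℕ.+ m) # 0#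
  pᵏ-pⁿ#0 k m = *-#0⇒#0ˡ (#-congʳ (sym eq) (x#y⇒x-y#0 (qᵐ#1 m)))
    where
    n = suc (k ℕ.+ m)
    eq : (p ^ k - p ^ n) * q ^ n ≈ q ^ suc m - 1#
    eq = begin
      (p ^ k - p ^ n) * q ^ n
        ≈⟨ solve 3 (λ x y z → (x :- y) :* z := x :* z :- y :* z) refl _ _ _ ⟩
      p ^ k * (q * q ^ (k ℕ.+ m)) - p ^ n * q ^ n
        ≈⟨ +-cong (*-congˡ (*-congˡ (^-homo-* q k m))) (-‿cong (pⁿqⁿ≈1 n)) ⟩
      p ^ k * (q * (q ^ k * q ^ m)) - 1#
        ≈⟨ +-congʳ (modulo (q * q ^ m) (pⁿqⁿ≈1 k) (solve 4 (λ P q Q M → P :* (q :* (Q :* M))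
             := q :* M :+ q :* M :* (P :* Q :- con (+ 1))) refl _ q _ _)) ⟩
      q ^ suc m - 1# ∎

  q⁻ⁿqⁱ#1 : ∀ n i → i < n → q⁻ⁿ n * q ^ i # 1#
  q⁻ⁿqⁱ#1 n i i<n = ≡.subst (λ n → q⁻ⁿ n * q ^ i # 1#) (ℕ.m+[n∸m]≡n i<n)
    (x-y#0⇒x#y (#-congʳ (sym eq) (*-#0 (-‿#0 (pᵏ-pⁿ#0 i m)) (^-#0 q#0 i))))
    where
    m = n ∸ suc i
    eq : q⁻ⁿ (suc (i ℕ.+ m)) * q ^ i - 1# ≈ - (p ^ i - p ^ suc (i ℕ.+ m)) * q ^ i
    eq = trans (+-congʳ (*-congʳ (q⁻ⁿ≈pⁿ (suc (i ℕ.+ m))))) (modulo 1# (pⁿqⁿ≈1 i)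
      (solve 3 (λ x P Q → x :* Q :- con (+ 1) := :- (P :- x) :* Q :+ con (+ 1) :* (P :* Q :- con (+ 1))) refl _ (p ^ i) (q ^ i)))

  poch-q#0 : ∀ n → poch q n # 0#
  poch-q#0 n = poch-#0 q n (λ m _ → qᵐ#1 m)

  -- The coefficient of xⁿ in pₙ, up to a factor that depends only on q and n.
  leading : ℕ → Carrier
  leading n = (2# ^ n) ⁻¹ * poch (q⁻ⁿ n) n * (poch q n) ⁻¹ * q ^ n

  leading#0 : ∀ n → leading n # 0#
  leading#0 n = *-#0 (*-#0 (*-#0 (⁻¹#0 (^-#0 2#0 n)) (poch-#0 _ n (q⁻ⁿqⁱ#1 n))) (⁻¹#0 (poch-q#0 n))) (^-#0 q#0 n)

  -- Up to W, φₖ receives λₖ Cₖ from itself and -μₖ Cₖ₊₁ from φₖ₊₁, which the recurrence sums to λₙ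
  -- Cₖ. Only the top term misses the contribution from above, and this defect vanishes for m = n.
  D-∑<-telescope : ∀ a n (C : ℕ → Carrier) → (∀ k → μ′ a k * C (suc k) ≈ (λ′ a k - λ′ a n) * C k) →
    ∀ m → D a (λ z → ∑< (suc m) (λ k → C k * φ (a 0F) k z)) ≐
      (λ z → W z * (λ′ a n * ∑< (suc m) (λ k → C k * φ (a 0F) k z) + (λ′ a m - λ′ a n) * C m * φ (a 0F) m z))
  D-∑<-telescope a n C rec zero z z#0 = begin
    D a (λ z → 0# + C 0 * φ (a 0F) 0 z) z       ≈⟨ D-const a (0# + C 0 * (1# * 1#)) z ⟩
    0#
      ≈⟨ solve 5 (λ W x l C E → con (+ 0) := W :* (l :* (con (+ 0) :+ C :* (con (+ 1) :* con (+ 1)))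
           :+ ((con (+ 1) :- con (+ 1)) :* E :- l) :* C :* (con (+ 1) :* con (+ 1)))) refl (W z) 0# (λ′ a n) (C 0) (1# - E a * 1#) ⟩
    W z * (λ′ a n * (0# + C 0 * φ (a 0F) 0 z) + (λ′ a 0 - λ′ a n) * C 0 * φ (a 0F) 0 z) ∎
  D-∑<-telescope a n C rec (suc m) z z#0 = begin
    D a (λ z → S z + C (suc m) * ψ (suc m) z) z
      ≈⟨ D-linear a S (ψ (suc m)) (C (suc m)) z ⟩
    D a S z + C (suc m) * D a (ψ (suc m)) z
      ≈⟨ +-cong (D-∑<-telescope a n C rec m z z#0) (*-congˡ (D-φ-suc a m z z#0)) ⟩
    W z * (λ′ a n * S z + (λ′ a m - λ′ a n) * C m * ψ m z)
      + C (suc m) * (W z * (λ′ a (suc m) * ψ (suc m) z - μ′ a m * ψ m z))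
      ≈⟨ modulo (- (W z * ψ m z)) (rec m) (solve 9 (λ W l S g f C x h μ →
           W :* (l :* S :+ g :* f) :+ C :* (W :* (x :* h :- μ :* f))
           := W :* (l :* (S :+ C :* h) :+ (x :- l) :* C :* h) :+ (:- (W :* f)) :* (μ :* C :- g))
           refl (W z) (λ′ a n) (S z) ((λ′ a m - λ′ a n) * C m) (ψ m z) (C (suc m)) (λ′ a (suc m)) (ψ (suc m) z) (μ′ a m)) ⟩
    W z * (λ′ a n * (S z + C (suc m) * ψ (suc m) z) + (λ′ a (suc m) - λ′ a n) * C (suc m) * ψ (suc m) z) ∎
    where
    ψ = φ (a 0F)
    S : Carrier → Carrier
    S z = ∑< (suc m) (λ k → C k * ψ k z)

  module _ (a : Vector Carrier 4) (generic : Generic q a) where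
    open Generic generic hiding (q#0; qᵐ#1)

    private
      ab = a 0F * a 1F
      ac = a 0F * a 2F
      ad = a 0F * a 3F

    abcdqⁿ⁻¹ : ℕ → Carrier
    abcdqⁿ⁻¹ n = a 0F * a 1F * a 2F * a 3F * q ^ᶻ (n ⊖ 1)

    product-a : product a ≈ a 0F * a 1F * a 2F * a 3F
    product-a = solve 4 (λ a b c d → a :* (b :* (c :* (d :* con (+ 1)))) := a :* b :* c :* d) refl _ _ _ _

    abcdqⁿ⁻¹≈Eqⁿ : ∀ n → abcdqⁿ⁻¹ n ≈ E a * q ^ n
    -- `0 ⊖ 1` is negative, so the power is here the inverse of `q ^ 1`.
    abcdqⁿ⁻¹≈Eqⁿ zero    = trans (*-cong (sym product-a) (⁻¹-cong (^-#0 q#0 1) (*-identityʳ q))) (sym (*-identityʳ _))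
    abcdqⁿ⁻¹≈Eqⁿ (suc n) = trans (*-congʳ (sym product-a)) (modulo (- (product a * q ^ n)) qp≈1
      (solve 4 (λ e p q Q → e :* Q := e :* p :* (q :* Q) :+ (:- (e :* Q)) :* (q :* p :- con (+ 1))) refl (product a) p q (q ^ n)))

    abcdqⁿ⁻¹-poch#0 : ∀ n → poch (abcdqⁿ⁻¹ n) n # 0#
    abcdqⁿ⁻¹-poch#0 zero    = 1#0
    abcdqⁿ⁻¹-poch#0 (suc n) = poch-#0 _ (suc n) λ i _ →
      #-congʳ (trans (*-congˡ (^-homo-* q n i)) (sym (*-assoc _ _ _))) (abcdqᵐ#1 (n ℕ.+ i))

    λ′#0 : ∀ n k → k < n → λ′ a k - λ′ a n # 0#
    λ′#0 n k k<n = ≡.subst (λ n → λ′ a k - λ′ a n # 0#) (ℕ.m+[n∸m]≡n k<n)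
      (#-congʳ (sym (λ′-difference a k (suc (k ℕ.+ m)))) (*-#0 (pᵏ-pⁿ#0 k m) (x#y⇒y-x#0 (#-congʳ (sym eq) (abcdqᵐ#1 (k ℕ.+ (k ℕ.+ m)))))))
      where
      m = n ∸ suc k
      -- One factor q of q^n absorbs the 1/q in `E`, which leaves the exponent k + n - 1 as a
      -- natural number.
      eq : E a * q ^ k * q ^ suc (k ℕ.+ m) ≈ a 0F * a 1F * a 2F * a 3F * q ^ (k ℕ.+ (k ℕ.+ m))
      eq = trans (modulo (product a * (q ^ k * q ^ (k ℕ.+ m))) qp≈1 (solve 5 (λ e p Q q Q′ → e :* p :* Q :* (q :* Q′)
        := e :* (Q :* Q′) :+ e :* (Q :* Q′) :* (q :* p :- con (+ 1))) refl (product a) p (q ^ k) q _))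
        (*-cong product-a (sym (^-homo-* q k (k ℕ.+ m))))

    numerator denominator : ℕ → Carrier
    numerator n   = pochs q (ab ∷ ac ∷ ad ∷ []) n
    denominator n = pochs q (q ∷ ab ∷ ac ∷ ad ∷ []) n

    numerator#0 : ∀ n → numerator n # 0#
    numerator#0 n = *-#0 (i≢j⇒#0 λ ()) (*-#0 (i≢j⇒#0 λ ()) (*-#0 (i≢j⇒#0 λ ()) 1#0))
      where
      i≢j⇒#0 : ∀ {i j} → i ≢ j → poch (a i * a j) n # 0#
      i≢j⇒#0 i≢j = poch-#0 _ n (λ m _ → aᵢaⱼqᵐ#1 i≢j m)

    coefficient : ℕ → ℕ → Carrier
    coefficient n k = numerator n / (2# ^ n * a 0F ^ n * poch (abcdqⁿ⁻¹ n) n)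
      * (poch (q⁻ⁿ n) k * poch (abcdqⁿ⁻¹ n) k / denominator k * q ^ k)

    askeyWilson-expansion : ∀ n z →
      askeyWilson q a n z ≈ ∑< (suc n) (λ k → coefficient n k * φ (a 0F) k z)
    askeyWilson-expansion n z = trans (*-congˡ (sum≈∑< (suc n) _)) (trans (*-distribˡ-∑< _ (suc n) _)
      (∑<-cong (suc n) (λ k _ → solve 7 (λ x N A u v i Q →
         -- The `con (+ 1)` after `i` is the sign-and-power factor of the series: for ₄φ₃ its
         -- exponent 1 + s - r is 0.
         x :* (N :* (A :* (u :* (v :* con (+ 1)))) :* i :* con (+ 1) :* Q) := x :* (N :* A :* i :* Q) :* (u :* v))
         refl _ (poch (q⁻ⁿ n) k) (poch (abcdqⁿ⁻¹ n) k) _ _ _ (q ^ k))))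

    -- Consecutive coefficients have the ratio q (1 - q^(k-n)) (1 - abcd q^(n+k-1)) / δ, where δ
    -- collects the new denominator factors, and `μ′` is q^(-k-1) δ. Since q^(-k) (1 - q^(k-n)) =
    -- q^(-k) - q^(-n), the product has the form given by `λ′-difference`.
    coefficient-suc : ∀ n k → μ′ a k * coefficient n (suc k) ≈ (λ′ a k - λ′ a n) * coefficient n k
    coefficient-suc n k = begin
      p * P * δ * (x * (poch N (suc k) * poch A (suc k) * i′ * (q * Q)))
        ≈⟨ *-congˡ (*-congˡ (*-congʳ (*-congʳ (*-cong (poch-snoc N k) (poch-snoc A k))))) ⟩
      p * P * δ * (x * (Nₖ * (1# - N * Q) * (Aₖ * (1# - A * Q)) * i′ * (q * Q)))
        ≈⟨ solve 12 (λ p P δ x n N a A Q i q u → p :* P :* δ :* (x :* (n :* u :* (a :* A) :* i :* (q :* Q)))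
             := P :* u :* A :* (q :* p) :* (x :* (n :* a :* (δ :* i) :* Q)))
             refl p P δ x Nₖ N Aₖ (1# - A * Q) Q i′ q (1# - N * Q) ⟩
      P * (1# - N * Q) * (1# - A * Q) * (q * p) * (x * (Nₖ * Aₖ * (δ * i′) * Q))
        ≈⟨ *-cong (trans (*-cong (*-cong P[1-NQ]≈ (+-congˡ (-‿cong AQ≈))) qp≈1) (*-identityʳ _))
                  (*-congˡ (*-congʳ (*-congˡ δi′≈i))) ⟩
      (P - p ^ n) * (1# - E a * Q * q ^ n) * (x * (Nₖ * Aₖ * i * Q))
        ≈⟨ *-congʳ (λ′-difference a k n) ⟨
      (λ′ a k - λ′ a n) * coefficient n k ∎
      where
      x = numerator n / (2# ^ n * a 0F ^ n * poch (abcdqⁿ⁻¹ n) n)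
      N = q⁻ⁿ n
      A = abcdqⁿ⁻¹ n
      Nₖ = poch N k
      Aₖ = poch A k
      Q = q ^ k
      P = p ^ k
      i = denominator k ⁻¹
      i′ = denominator (suc k) ⁻¹
      δ = (1# - q * Q) * ((1# - ab * Q) * ((1# - ac * Q) * (1# - ad * Q)))
      denominator#0 : ∀ k → denominator k # 0#
      denominator#0 k = *-#0 (poch-q#0 k) (numerator#0 k)
      P[1-NQ]≈ : P * (1# - N * Q) ≈ P - p ^ n
      P[1-NQ]≈ = modulo (- N) (pⁿqⁿ≈1 k) (trans (solve 3 (λ P N Q →
        P :* (con (+ 1) :- N :* Q) := P :- N :+ (:- N) :* (P :* Q :- con (+ 1))) refl P N Q)
        (+-congʳ (+-congˡ (-‿cong (q⁻ⁿ≈pⁿ n)))))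
      AQ≈ : A * Q ≈ E a * Q * q ^ n
      AQ≈ = trans (*-congʳ (abcdqⁿ⁻¹≈Eqⁿ n)) (solve 3 (λ e x y → e :* x :* y := e :* y :* x) refl _ _ Q)
      δ*denominator : δ * denominator k ≈ denominator (suc k)
      δ*denominator = trans
        (solve 8 (λ q b c d q′ b′ c′ d′ → q :* (b :* (c :* d)) :* (q′ :* (b′ :* (c′ :* (d′ :* con (+ 1)))))
          := q′ :* q :* (b′ :* b :* (c′ :* c :* (d′ :* d :* con (+ 1))))) refl _ _ _ _ _ _ _ _)
        (sym (*-cong (poch-snoc q k) (*-cong (poch-snoc ab k) (*-cong (poch-snoc ac k) (*-congʳ (poch-snoc ad k))))))
      δi′≈i : δ * i′ ≈ i
      δi′≈i = xy≈1⇒y≈x⁻¹ (trans (solve 3 (λ d δ i → d :* (δ :* i) := δ :* d :* i) refl _ δ i′)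
        (trans (*-congʳ δ*denominator) (⁻¹-inverseʳ (denominator#0 (suc k)))))

    askeyWilson-eigenfunction : ∀ n →
      D a (askeyWilson q a n) ≐ (λ z → W z * (λ′ a n * askeyWilson q a n z))
    askeyWilson-eigenfunction n z z#0 = begin
      D a (askeyWilson q a n) z
        ≈⟨ D-cong a (λ z _ → askeyWilson-expansion n z) z z#0 ⟩
      D a S z
        ≈⟨ D-∑<-telescope a n (coefficient n) (coefficient-suc n) n z z#0 ⟩
      W z * (λ′ a n * S z + (λ′ a n - λ′ a n) * coefficient n n * φ (a 0F) n z)
        ≈⟨ solve 5 (λ W l S C f → W :* (l :* S :+ (l :- l) :* C :* f) := W :* (l :* S)) refl (W z) (λ′ a n) (S z) (coefficient n n) _ ⟩
      W z * (λ′ a n * S z)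
        ≈⟨ *-congˡ (*-congˡ (askeyWilson-expansion n z)) ⟨
      W z * (λ′ a n * askeyWilson q a n z) ∎
      where
      S : Carrier → Carrier
      S z = ∑< (suc n) (λ k → coefficient n k * φ (a 0F) k z)

    askeyWilson-lower : ℕ → Carrier → Carrier
    askeyWilson-lower n z = ∑< n (λ k → coefficient n k * φ (a 0F) k z)

    askeyWilson-lower-Below : ∀ n → Below (φ (a 0F)) n (askeyWilson-lower n)
    askeyWilson-lower-Below n = Below-∑< n _ (λ k k<n → Below-≤ k<n (Below-ψ k _))

    -- For k = n both (ab, ac, ad; q)ₙ and (abcdq^(n-1); q)ₙ occur once in a numerator and once in a
    -- denominator, so a^(-n) is the only trace of the parameters.
    coefficient-top : ∀ n → coefficient n n * a 0F ^ n ≈ leading n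
    coefficient-top n = begin
      T * (t * α * A) ⁻¹ * (N * A * (q′ * T) ⁻¹ * Q) * α
        ≈⟨ *-congʳ (*-cong (*-congˡ (trans (sym (⁻¹-*-homo (*-#0 t#0 α#0) A#0)) (*-congʳ (sym (⁻¹-*-homo t#0 α#0)))))
             (*-congʳ (*-congˡ (sym (⁻¹-*-homo (poch-q#0 n) T#0))))) ⟩
      T * (t ⁻¹ * α ⁻¹ * A ⁻¹) * (N * A * (q′ ⁻¹ * T ⁻¹) * Q) * α
        ≈⟨ solve 10 (λ T T′ t α α′ A A′ N q Q → T :* (t :* α′ :* A′) :* (N :* A :* (q :* T′) :* Q) :* α
             := t :* N :* q :* Q :* ((T :* T′) :* ((α :* α′) :* (A :* A′)))) refl T (T ⁻¹) (t ⁻¹) α (α ⁻¹) A (A ⁻¹) N (q′ ⁻¹) Q ⟩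
      leading n * (T * T ⁻¹ * (α * α ⁻¹ * (A * A ⁻¹)))
        ≈⟨ *-congˡ (*-cong (⁻¹-inverseʳ T#0) (*-cong (⁻¹-inverseʳ α#0) (⁻¹-inverseʳ A#0))) ⟩
      leading n * (1# * (1# * 1#))
        ≈⟨ solve 1 (λ x → x :* (con (+ 1) :* (con (+ 1) :* con (+ 1))) := x) refl _ ⟩
      leading n ∎
      where
      T = numerator n
      t = 2# ^ n
      α = a 0F ^ n
      A = poch (abcdqⁿ⁻¹ n) n
      N = poch (q⁻ⁿ n) n
      q′ = poch q n
      Q = q ^ n
      T#0 = numerator#0 n
      t#0 = ^-#0 2#0 n
      α#0 = ^-#0 (a#0 0F) n
      A#0 = abcdqⁿ⁻¹-poch#0 n

    -- The coefficient of φₙ in pₙ is invertible by `coefficient-top`, whereas each pₖ with k < n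
    -- lies in the span of φ₀, ..., φₙ₋₁.
    askeyWilson-independent : Independent (askeyWilson q a)
    askeyWilson-independent n t ∑≈0 = xy≈0⇒x≈0 (*-#0⇒#0ˡ (#-congʳ (sym (coefficient-top n)) (leading#0 n)))
      (φ-top≈0 (a#0 0F) (Below-+ (Below-∑< n _ (λ k k<n → Below-resp (λ z _ → *-congˡ (sym (askeyWilson-expansion k z)))
          (Below-* (t k) (Below-≤ k<n (askeyWilson-Below k)))))
          (Below-* (t n) (askeyWilson-lower-Below n))) _ λ j → let z = q ^ suc j in begin
        S z + t n * L z + t n * coefficient n n * φ (a 0F) n z
          ≈⟨ solve 5 (λ S t L c f → S :+ t :* L :+ t :* c :* f := S :+ t :* (L :+ c :* f)) refl (S z) (t n) (L z) _ _ ⟩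
        S z + t n * (L z + coefficient n n * φ (a 0F) n z)
          ≈⟨ +-congˡ (*-congˡ (askeyWilson-expansion n z)) ⟨
        S z + t n * askeyWilson q a n z
          ≈⟨ ∑≈0 z (^-#0 q#0 (suc j)) ⟩
        0# ∎)
      where
      S L : Carrier → Carrier
      S z = ∑< n (λ k → t k * askeyWilson q a k z)
      L = askeyWilson-lower n
      askeyWilson-Below : ∀ k → Below (φ (a 0F)) (suc k) (λ z → ∑< (suc k) (λ j → coefficient k j * φ (a 0F) j z))
      askeyWilson-Below k = adjoin (askeyWilson-lower-Below k) (coefficient k k) (λ _ _ → refl)

  module _ (a : Vector Carrier 4) (generic : Generic q a) (π : Permutation′ 4) where
    open Generic generic hiding (q#0; qᵐ#1)

    private
      aπ : Vector Carrier 4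
      aπ = a ∘ (π ⟨$⟩ʳ_)

    product-aπ : product a ≈ product aπ
    product-aπ = product-permute a π

    generic-permute : Generic q aπ
    generic-permute = record
      { q#0      = q#0
      ; qᵐ#1     = qᵐ#1
      ; a#0      = λ i → a#0 (π ⟨$⟩ʳ i)
      ; aᵢaⱼqᵐ#1 = λ i≢j → aᵢaⱼqᵐ#1 (i≢j ∘ Injection.injective (↔⇒↣ π))
      ; abcdqᵐ#1 = λ m → #-congʳ (*-congʳ (trans (sym (product-a a generic)) (trans product-aπ abcd))) (abcdqᵐ#1 m)
      }
      where
      abcd : product aπ ≈ aπ 0F * aπ 1F * aπ 2F * aπ 3F
      abcd = solve 4 (λ a b c d → a :* (b :* (c :* (d :* con (+ 1)))) := a :* b :* c :* d) refl _ _ _ _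

    D-permute : ∀ f z → D aπ f z ≈ D a f z
    D-permute f z = sym (+-cong (*-congʳ (*-congˡ (product-permute (λ i → 1# - a i * z) π)))
                                (*-congʳ (*-congˡ (product-permute (λ i → z - a i) π))))

    λ′-permute : ∀ k → λ′ aπ k ≈ λ′ a k
    λ′-permute k = sym (*-congˡ (+-congˡ (-‿cong (*-congʳ (*-congʳ product-aπ)))))

    askeyWilson-permute : ∀ n → askeyWilson q aπ n ≐ askeyWilson q a n
    askeyWilson-permute n z z#0 = x∙y⁻¹≈ε⇒x≈y _ _
      (trans (solve 2 (λ x y → x :- y := x :+ :- con (+ 1) :* y) refl (f′ z) (f z))
        (eigenfunction-Below⇒≈0 a (a#0 0F) n (λ′#0 a generic n) ℕ.≤-refl
          -- After rebasing, the φₙ-terms of the two polynomials cancel, so their difference is a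
          -- combination of `L′`, `g` and `L`, all below φₙ.
          (Below-resp difference (Below-+ (Below-+ (Below-rebase (a#0 0F) (aπ 0F) (askeyWilson-lower-Below aπ generic-permute n))
             (Below-* C′ g<)) (Below-* (- 1#) (askeyWilson-lower-Below a generic n))))
          eigen z z#0))
      where
      f f′ h L L′ : Carrier → Carrier
      f  = askeyWilson q a n
      f′ = askeyWilson q aπ n
      h z = f′ z + - 1# * f z
      L  = askeyWilson-lower a generic n
      L′ = askeyWilson-lower aπ generic-permute n
      C  = coefficient a generic n n
      C′ = coefficient aπ generic-permute n n
      rebased = φ-rebase (a#0 0F) (aπ 0F) n
      κ  = proj₁ rebased
      g  = proj₁ (proj₂ rebased)
      g< = proj₁ (proj₂ (proj₂ rebased))
      φπ≐ = proj₁ (proj₂ (proj₂ (proj₂ rebased)))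
      κa≈b = proj₂ (proj₂ (proj₂ (proj₂ rebased)))

      -- With b the first parameter after the permutation, C′ κ aⁿ = C′ bⁿ = `leading n` = C aⁿ, and
      -- aⁿ cancels.
      C′κ≈C : C′ * κ ≈ C
      C′κ≈C = *-cancelˡ (^-#0 (a#0 0F) n) (begin
        a 0F ^ n * (C′ * κ)     ≈⟨ solve 3 (λ a C k → a :* (C :* k) := C :* (k :* a)) refl _ C′ κ ⟩
        C′ * (κ * a 0F ^ n)     ≈⟨ *-congˡ κa≈b ⟩
        C′ * aπ 0F ^ n          ≈⟨ coefficient-top aπ generic-permute n ⟩
        leading n ≈⟨ coefficient-top a generic n ⟨
        C * a 0F ^ n            ≈⟨ *-comm _ _ ⟩
        a 0F ^ n * C            ∎)

      difference : (λ z → L′ z + C′ * g z + - 1# * L z) ≐ h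
      difference z z#0 = begin
        L′ z + C′ * g z + - 1# * L z
          ≈⟨ modulo (- φ (a 0F) n z) C′κ≈C (solve 7 (λ L′ C′ g L k f C → L′ :+ C′ :* g :+ :- con (+ 1) :* L
               := L′ :+ C′ :* (g :+ k :* f) :+ :- con (+ 1) :* (L :+ C :* f) :+ (:- f) :* (C′ :* k :- C))
               refl (L′ z) C′ (g z) (L z) κ (φ (a 0F) n z) C) ⟩
        L′ z + C′ * (g z + κ * φ (a 0F) n z) + - 1# * (L z + C * φ (a 0F) n z)
          ≈⟨ +-cong (trans (+-congˡ (*-congˡ (sym (φπ≐ z z#0)))) (sym (askeyWilson-expansion aπ generic-permute n z)))
                    (*-congˡ (sym (askeyWilson-expansion a generic n z))) ⟩
        h z ∎

      eigen : D a h ≐ (λ z → W z * (λ′ a n * h z))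
      eigen z z#0 = begin
        D a h z
          ≈⟨ D-linear a f′ f (- 1#) z ⟩
        D a f′ z + - 1# * D a f z
          ≈⟨ +-cong (trans (sym (D-permute f′ z)) (trans (askeyWilson-eigenfunction aπ generic-permute n z z#0)
               (*-congˡ (*-congʳ (λ′-permute n))))) (*-congˡ (askeyWilson-eigenfunction a generic n z z#0)) ⟩
        W z * (λ′ a n * f′ z) + - 1# * (W z * (λ′ a n * f z))
          ≈⟨ solve 4 (λ W l g f → W :* (l :* g) :+ :- con (+ 1) :* (W :* (l :* f)) := W :* (l :* (g :+ :- con (+ 1) :* f)))
               refl (W z) (λ′ a n) (f′ z) (f z) ⟩
        W z * (λ′ a n * h z) ∎

-- Independence of the continuous q-Hermite polynomials

module QHermite
  {c ℓ₁ ℓ₂} (F : HeytingField c ℓ₁ ℓ₂)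
  (_#?_ : Decidable (HeytingField._#_ F))
  (2#0 : HeytingField._#_ F (AskeyWilson.2# F _#?_) (HeytingField.0# F))
  (q : HeytingField.Carrier F)
  (q#0 : HeytingField._#_ F q (HeytingField.0# F))
  (qᵐ#1 : ∀ m → HeytingField._#_ F (AskeyWilson._^_ F _#?_ q (suc m)) (HeytingField.1# F))
  where

  open HeytingField F
  open AskeyWilson F _#?_ hiding (poch; φ)
  open Field F _#?_
  open Pochhammer F _#?_ q
  open import Data.Nat.Combinatorics using (_C_)
  open import Relation.Binary.Reasoning.Setoid setoid

  -- Powers of z are lowered by (qz)^(k+1) - z^(k+1) = (1 - q^(k+1)) (-z) z^k, so one family serves
  -- for all i.
  monomial-top≈0 : ∀ {m g} → Below (λ k z → z ^ k) m g → ∀ x →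
    (∀ j → g (q ^ suc j) + x * (q ^ suc j) ^ m ≈ 0#) → x ≈ 0#
  monomial-top≈0 = vanishing⇒top≈0 {i = 0}
    where
    open Lowering q q#0 qᵐ#1 (λ _ k z → z ^ k) (λ _ z → - z) (λ _ _ → refl)
      (λ _ k z _ → trans (+-congʳ (^-distrib-* q z (suc k)))
        (solve 3 (λ r z Z → r :* (z :* Z) :- z :* Z := (con (+ 1) :- r) :* (:- z :* Z)) refl (q ^ suc k) z (z ^ k)))
      (λ _ j → -‿#0 (^-#0 q#0 (suc j)))

  power-cancel : ∀ {z} → z # 0# → ∀ i l m → z ^ (i ℕ.+ l) * z ^ (i ℕ.+ m) * ((z ^ 2) ⁻¹) ^ i ≈ z ^ (l ℕ.+ m)
  power-cancel {z} z#0 zero l m = trans (*-identityʳ _) (sym (^-homo-* z l m))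
  power-cancel {z} z#0 (suc i) l m = begin
    z * x * (z * y) * (v * u)     ≈⟨ solve 5 (λ z x y v u → z :* x :* (z :* y) :* (v :* u) := z :^ 2 :* v :* (x :* y :* u)) refl z x y v u ⟩
    z ^ 2 * v * (x * y * u)       ≈⟨ *-cong (⁻¹-inverseʳ (^-#0 z#0 2)) (power-cancel z#0 i l m) ⟩
    1# * z ^ (l ℕ.+ m)            ≈⟨ *-identityˡ _ ⟩
    z ^ (l ℕ.+ m)                 ∎
    where
    x = z ^ (i ℕ.+ l)
    y = z ^ (i ℕ.+ m)
    v = (z ^ 2) ⁻¹
    u = v ^ i

  -- This multiplies z^(n-2i) in Hₙ. For ₂φ₀ the exponent 1 + s - r is -1, hence the inverse of a
  -- first power.
  coefficient : ℕ → ℕ → Carrier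
  coefficient n i = (2# ^ n) ⁻¹ *
    (pochs q (q ^ᶻ (ℤ.- (+ n)) ∷ 0# ∷ []) i / pochs q (q ∷ []) i * (((- 1#) ^ i * q ^ (i C 2)) ^ 1) ⁻¹ * (q ^ n) ^ i)

  coefficient-0#0 : ∀ n → coefficient n 0 # 0#
  coefficient-0#0 n = *-#0 (⁻¹#0 (^-#0 2#0 n)) (*-#0 (*-#0 (/-#0 (*-#0 1#0 (*-#0 1#0 1#0)) (*-#0 1#0 1#0))
    (⁻¹#0 (^-#0 (*-#0 1#0 (^-#0 q#0 (0 C 2))) 1))) 1#0)

  -- The factor zⁿ clears the negative powers of z in all H₀, …, Hₙ.
  qHermite-expansion : ∀ n k → k ≤ n →
    (λ z → z ^ n * qHermite q k z) ≐ (λ z → ∑< (suc k) (λ i → coefficient k i * z ^ ((n ∸ i) ℕ.+ (k ∸ i))))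
  qHermite-expansion n k k≤n z z#0 = begin
    z ^ n * qHermite q k z
      ≈⟨ *-assoc _ _ _ ⟨
    z ^ n * (z ^ k / 2# ^ k) * Σ[k≤ k ] term
      ≈⟨ trans (*-congˡ (sum≈∑< (suc k) term)) (*-distribˡ-∑< _ (suc k) term) ⟩
    ∑< (suc k) (λ i → z ^ n * (z ^ k / 2# ^ k) * term i)
      ≈⟨ ∑<-cong (suc k) (λ { i (s≤s i≤k) → begin
        z ^ n * (z ^ k / 2# ^ k) * (h i * (q ^ k * (z ^ 2) ⁻¹) ^ i)
          ≈⟨ *-congˡ (*-congˡ (^-distrib-* (q ^ k) ((z ^ 2) ⁻¹) i)) ⟩
        z ^ n * (z ^ k / 2# ^ k) * (h i * ((q ^ k) ^ i * ((z ^ 2) ⁻¹) ^ i))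
          ≈⟨ solve 6 (λ N K t h Q u → N :* (K :* t) :* (h :* (Q :* u)) := t :* (h :* Q) :* (N :* K :* u)) refl _ _ _ (h i) _ _ ⟩
        coefficient k i * (z ^ n * z ^ k * ((z ^ 2) ⁻¹) ^ i)
          ≡⟨ ≡.cong₂ (λ l m → coefficient k i * (z ^ l * z ^ m * ((z ^ 2) ⁻¹) ^ i))
               (ℕ.m+[n∸m]≡n (ℕ.≤-trans i≤k k≤n)) (ℕ.m+[n∸m]≡n i≤k) ⟨
        coefficient k i * (z ^ (i ℕ.+ (n ∸ i)) * z ^ (i ℕ.+ (k ∸ i)) * ((z ^ 2) ⁻¹) ^ i)
          ≈⟨ *-congˡ (power-cancel z#0 i (n ∸ i) (k ∸ i)) ⟩
        coefficient k i * z ^ ((n ∸ i) ℕ.+ (k ∸ i)) ∎ }) ⟩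
    ∑< (suc k) (λ i → coefficient k i * z ^ ((n ∸ i) ℕ.+ (k ∸ i))) ∎
    where
    h term : ℕ → Carrier
    h i = pochs q (q ^ᶻ (ℤ.- (+ k)) ∷ 0# ∷ []) i / pochs q (q ∷ []) i * (((- 1#) ^ i * q ^ (i C 2)) ^ 1) ⁻¹
    term i = h i * (q ^ k * (z ^ 2) ⁻¹) ^ i

  -- After multiplication by zⁿ the exponents are (n - i) + (k - i). The value 2n occurs only for k
  -- = n and i = 0, so z^(2n) carries tₙ times the invertible `coefficient n 0`.
  qHermite-independent : Independent (qHermite q)
  qHermite-independent n t ∑≈0 = xy≈0⇒x≈0 (coefficient-0#0 n) (monomial-top≈0 (Below-+
      (Below-∑< n _ (λ k k<n → Below-* (t k) (Below-∑< (suc k) _ (λ i _ → Below-≤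
        (ℕ.+-mono-≤-< (ℕ.m∸n≤m n i) (ℕ.≤-<-trans (ℕ.m∸n≤m k i) k<n)) (Below-ψ _ (coefficient k i))))))
      (Below-* (t n) (Below-∑< n _ (λ i i<n → Below-≤
        (ℕ.+-mono-< (ℕ.∸-monoʳ-< (s≤s z≤n) i<n) (ℕ.∸-monoʳ-< (s≤s z≤n) i<n)) (Below-ψ _ (coefficient n (suc i)))))))
    _ λ j → let z = q ^ suc j ; z#0 = ^-#0 q#0 (suc j) in begin
      ∑< n (λ k → t k * G k z) + t n * T z + t n * coefficient n 0 * z ^ (n ℕ.+ n)
        ≈⟨ solve 5 (λ S t T c x → S :+ t :* T :+ t :* c :* x := S :+ t :* (c :* x :+ T)) refl _ (t n) (T z) _ _ ⟩
      ∑< n (λ k → t k * G k z) + t n * (coefficient n 0 * z ^ (n ℕ.+ n) + T z)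
        ≈⟨ +-cong (∑<-cong n (λ k k<n → *-congˡ (sym (qHermite-expansion n k (ℕ.<⇒≤ k<n) z z#0))))
             (*-congˡ (trans (∑<-cons n _) (sym (qHermite-expansion n n ℕ.≤-refl z z#0)))) ⟩
      ∑< (suc n) (λ k → t k * (z ^ n * qHermite q k z))
        ≈⟨ ∑<-cong (suc n) (λ k _ → solve 3 (λ t x H → t :* (x :* H) := x :* (t :* H)) refl (t k) _ _) ⟩
      ∑< (suc n) (λ k → z ^ n * (t k * qHermite q k z))
        ≈⟨ *-distribˡ-∑< _ (suc n) _ ⟨
      z ^ n * ∑< (suc n) (λ k → t k * qHermite q k z)
        ≈⟨ *-congˡ (∑≈0 z z#0) ⟩
      z ^ n * 0#   ≈⟨ zeroʳ _ ⟩
      0#           ∎)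
    where
    G : ℕ → Carrier → Carrier
    G k z = ∑< (suc k) (λ i → coefficient k i * z ^ ((n ∸ i) ℕ.+ (k ∸ i)))
    T : Carrier → Carrier
    T z = ∑< n (λ i → coefficient n (suc i) * z ^ ((n ∸ suc i) ℕ.+ (n ∸ suc i)))

-- Symmetry of the mixed moments

module Symmetry
  {c ℓ₁ ℓ₂} (F : HeytingField c ℓ₁ ℓ₂)
  (_#?_ : Decidable (HeytingField._#_ F))
  (2#0 : HeytingField._#_ F (AskeyWilson.2# F _#?_) (HeytingField.0# F))
  (q : HeytingField.Carrier F)
  (a : Vector (HeytingField.Carrier F) 4)
  (π : Permutation′ 4)
  (generic : AskeyWilson.Generic F _#?_ q a)
  where

  open HeytingField F
  open AskeyWilson F _#?_
  open Field F _#?_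
  open Generic generic using (q#0; qᵐ#1)
  open AWPolynomials F _#?_ 2#0 q q#0 qᵐ#1
  open QHermite F _#?_ 2#0 q q#0 qᵐ#1 using (qHermite-independent)

  -- By `askeyWilson-permute` the second expansion is also one in the unpermuted polynomials, whose
  -- independence identifies the coefficients.
  mixedMoment-symmetric : ∀ s s′ → IsMixedMoment q a s → IsMixedMoment q (a ∘ (π ⟨$⟩ʳ_)) s′ →
    ∀ n k → k ≤ n → s n k ≈ s′ n k
  mixedMoment-symmetric s s′ H≈ H≈′ =
    connection-unique q (askeyWilson-independent a generic) H≈ λ n z z#0 →
      trans (H≈′ n z z#0) (trans (sum≈∑< (suc n) (λ k → s′ n k * askeyWilson q (a ∘ (π ⟨$⟩ʳ_)) k z))
        (trans (∑<-cong (suc n) (λ k _ → *-congˡ (askeyWilson-permute a generic π k z z#0)))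
          (sym (sum≈∑< (suc n) (λ k → s′ n k * askeyWilson q a k z)))))

  dualMixedMoment-symmetric : ∀ s s′ → IsDualMixedMoment q a s → IsDualMixedMoment q (a ∘ (π ⟨$⟩ʳ_)) s′ →
    ∀ n k → k ≤ n → s n k ≈ s′ n k
  dualMixedMoment-symmetric s s′ p≈ p≈′ =
    connection-unique q qHermite-independent p≈ λ n z z#0 →
      trans (sym (askeyWilson-permute a generic π n z z#0)) (p≈′ n z z#0)

theorem6p11 : ∀ {c ℓ₁ ℓ₂} (F : HeytingField c ℓ₁ ℓ₂) (_#?_ : Decidable (HeytingField._#_ F)) →
  let open HeytingField F
      open AskeyWilson F _#?_
  in 2# # 0# →
     (q : Carrier) (a : Vector Carrier 4) (π : Permutation′ 4) →
     let aπ = a ∘ (π ⟨$⟩ʳ_) in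
     ((𝐢 : Carrier) → 𝐢 * 𝐢 ≈ - 1# → Generic q (𝐢 · a) →
        (s s′ : ℕ → ℕ → Carrier) →
        IsMixedMoment q (𝐢 · a) s → IsMixedMoment q (𝐢 · aπ) s′ →
        ∀ n k → k ≤ n → rescale 𝐢 s n k ≈ rescale 𝐢 s′ n k)
     × (Generic q a → (s s′ : ℕ → ℕ → Carrier) →
        IsMixedMoment q a s → IsMixedMoment q aπ s′ →
        ∀ n k → k ≤ n → s n k ≈ s′ n k)
     × (Generic q a → (s s′ : ℕ → ℕ → Carrier) →
        IsDualMixedMoment q a s → IsDualMixedMoment q aπ s′ →
        ∀ n k → k ≤ n → s n k ≈ s′ n k)
theorem6p11 F _#?_ 2#0 q a π =
    -- Scaling by `𝐢` commutes definitionally with permuting the parameters, and the rescaling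
    -- factor depends only on n - k.
    (λ 𝐢 _ generic s s′ σ σ′ n k k≤n →
       *-congˡ (mixedMoment-symmetric (𝐢 · a) π generic s s′ σ σ′ n k k≤n))
  , mixedMoment-symmetric a π
  , dualMixedMoment-symmetric a π
  where
  open HeytingField F using (*-congˡ)
  open AskeyWilson F _#?_ using (_·_)
  open Symmetry F _#?_ 2#0 q
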